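{- Let $k\geq 12$ be a positive integer. Let $A$ be a finite set of $k$ integers such that $\min(A)=0$, $\gcd(A)=1$, and $|3^{\wedge}A| = 3k-6$. Then $A=[0,k+1]\setminus\{x,y\}$, where $\{x,y\}$ is one of the sets $\{1,2\}$, $\{k-1,k\}$, $\{1,k\}$, $\{2,k+1\}$, $\{3,k+1\}$, $\{k-2,k+1\}$, $\{k-3,k+1\}$.
   Context: For a finite set $A$ of integers and a positive integer $h\le |A|$, the restricted $h$-fold sumset $h^{\wedge}A$ is the set of all sums of $h$ distinct elements of $A$. For integers $\alpha\le\beta$, $[\alpha,\beta]=\{x\in\mathbb{Z}:\alpha\le x\le\beta\}$. $\gcd(A)$ denotes the greatest common divisor of the elements of $A$. -}

module Defs where

open import Data.Nat using (ℕ)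
open import Data.Integer using (ℤ; +_; _+_; _≤_)
open import Data.Integer.GCD using (gcd)
open import Data.List using (List; foldr; length)
open import Data.List.Membership.Propositional using (_∈_)
open import Data.List.Relation.Unary.Unique.Propositional using (Unique)
open import Data.Product using (Σ; ∃; _×_; _,_)
open import Relation.Binary.PropositionalEquality using (_≡_; _≢_)
open import Function.Bundles using (_⇔_)

-- A finite set of integers is represented by a duplicate-free list.

gcdList : List ℤ → ℤ
gcdList = foldr gcd (+ 0)

InRestricted3Sum : List ℤ → ℤ → Set
InRestricted3Sum A z =
  Σ ℤ λ a → Σ ℤ λ b → Σ ℤ λ c →
    a ∈ A × b ∈ A × c ∈ A × a ≢ b × a ≢ c × b ≢ c × z ≡ a + b + c

HasCard : (ℤ → Set) → ℕ → Set
HasCard P n = Σ (List ℤ) λ S → Unique S × length S ≡ n × (∀ z → (z ∈ S ⇔ P z))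

MinIsZero : List ℤ → Set
MinIsZero A = (+ 0 ∈ A) × (∀ a → a ∈ A → + 0 ≤ a)

IsIntervalMinusTwo : List ℤ → ℕ → ℤ → ℤ → Set
IsIntervalMinusTwo A k x y =
  ∀ z → (z ∈ A ⇔ ((+ 0 ≤ z × z ≤ + (k Data.Nat.+ 1)) × z ≢ x × z ≢ y))

{-# OPTIONS --safe #-}

-- Order A as a₀ < … < aₙ with gaps gᵢ = aᵢ₊₁ − aᵢ, and grade the sums aᵢ + aⱼ + aₗ
-- (i < j < l) by i + j + l.  Raising one index at a time gives an increasing chain of
-- 3k − 8 sums from the least to the greatest, so |3^A| = 3k − 6 leaves room for only two
-- more.  If gᵢ ≢ gⱼ, raising i and j in either order gives two different sums between
-- the same neighbours, so the chain gains a sum; gains at successive places of the chain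
-- add up.  If two gaps at distance at least three from both ends differed, each other gap
-- would differ from one of them, which yields three gains; so the interior gaps equal
-- some d.  Near each end a gap different from d costs one or two gains, and at least
-- three unless it is a small multiple of d as in the theorem.  The costs of the two ends
-- add up, gcd(A) = 1 forces d = 1, and if the total cost is at most one then all sums lie
-- in an interval with fewer than 3k − 6 elements.
module Submission where

open import Defs
open import Data.Bool using (Bool; T; _∧_; if_then_else_; true; false)
open import Data.Bool.Properties using (T-∧)
open import Data.Empty using (⊥)
open import Data.Fin using (zero; suc)
open import Data.Fin.Properties using (injective⇒≤)
open import Data.Integer as ℤ using (ℤ; +_; ∣_∣)
import Data.Integer.Divisibility as ℤ
import Data.Integer.GCD as ℤ
import Data.Integer.Properties as ℤ
open import Data.List using (List; []; _∷_; length; lookup; map; upTo)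
open import Data.List.Membership.Propositional using (_∈_)
open import Data.List.Membership.Propositional.Properties using (∈-lookup; ∈-map⁺; ∈-map⁻; ∈-upTo⁺)
open import Data.List.Properties using (length-map; length-upTo)
open import Data.List.Relation.Binary.Permutation.Propositional using (_↭_; ↭-sym; ↭⇒↭ₛ)
open import Data.List.Relation.Binary.Permutation.Propositional.Properties using (∈-resp-↭; ↭-length)
import Data.List.Relation.Binary.Permutation.Setoid.Properties as Permutation
open import Data.List.Relation.Unary.All as All using (All; []; _∷_)
open import Data.List.Relation.Unary.AllPairs as AllPairs using (AllPairs; []; _∷_)
import Data.List.Relation.Unary.AllPairs.Properties as AllPairs
open import Data.List.Relation.Unary.Any as Any using (here; there)
open import Data.List.Relation.Unary.Any.Properties using (lookup-index)
open import Data.List.Relation.Unary.Sorted.TotalOrder.Properties using (Sorted⇒AllPairs)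
open import Data.List.Relation.Unary.Unique.Propositional using (Unique)
open import Data.Nat
open import Data.Nat.Divisibility
open import Data.Nat.Properties
open import Data.Nat.Tactic.RingSolver using (solve-∀)
open import Data.List.Sort ≤-decTotalOrder using (sort; sort-↭; sort-↗)
open import Data.Product using (∃; _×_; _,_; proj₁; proj₂)
open import Data.Sum using (_⊎_; inj₁; inj₂)
open import Data.Unit using (tt)
open import Function using (_∘_; mk⇔)
open import Function.Bundles using (Equivalence)
open import Relation.Binary.Definitions using (tri<; tri≈; tri>)
open import Relation.Binary.PropositionalEquality
open import Relation.Nullary

-- Index triples, their ranks and their sums

Triple : Set
Triple = ℕ × ℕ × ℕ

rank : Triple → ℕ
rank (i , j , l) = i + j + l

point : (ℕ → ℕ) → ℕ → ℕ
point g zero    = 0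
point g (suc i) = point g i + g i

value : (ℕ → ℕ) → Triple → ℕ
value g (i , j , l) = point g i + point g j + point g l

Valid : ℕ → Triple → Set
Valid n (i , j , l) = i < j × j < l × l ≤ n

infix 4 _≼_
_≼_ : Triple → Triple → Set
(i , j , l) ≼ (i' , j' , l') = i ≤ i' × j ≤ j' × l ≤ l'

-- Bounds the number of sums through triples with pairwise different values, so that the vertices of
-- a chain can be counted against it directly.
AtMost : (ℕ → ℕ) → ℕ → ℕ → Set
AtMost g n N = ∀ Ts → All (Valid n) Ts → AllPairs (λ T U → value g T ≢ value g U) Ts → length Ts ≤ N

-- Increasing chains of sums and their gains

module Paths (g : ℕ → ℕ) (g>0 : ∀ i → 0 < g i) (n : ℕ) where

  infixr 5 _∷⟨_⟩_

  -- A step only has to increase the value. The ranks of neighbours are unconstrained, so a chain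
  -- may visit several triples of equal rank; this is how surplus sums enter.
  data Path : Triple → Triple → ℕ → Set where
    [_]    : ∀ {T} → Valid n T → Path T T 0
    _∷⟨_⟩_ : ∀ {T U V s} → Valid n T → value g T < value g U → Path U V s → Path T V (suc s)

  _⊙_ : ∀ {T U V s t} → Path T U s → Path U V t → Path T V (s + t)
  [ _ ]          ⊙ q = q
  (v ∷⟨ lt ⟩ p) ⊙ q = v ∷⟨ lt ⟩ (p ⊙ q)

  vertices : ∀ {T U s} → Path T U s → List Triple
  vertices {T} [ _ ]          = T ∷ []
  vertices {T} (_ ∷⟨ _ ⟩ p) = T ∷ vertices p

  vertices-length : ∀ {T U s} (p : Path T U s) → length (vertices p) ≡ suc s
  vertices-length [ _ ]         = refl
  vertices-length (_ ∷⟨ _ ⟩ p) = cong suc (vertices-length p)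

  vertices-valid : ∀ {T U s} (p : Path T U s) → All (Valid n) (vertices p)
  vertices-valid [ v ]         = v ∷ []
  vertices-valid (v ∷⟨ _ ⟩ p) = v ∷ vertices-valid p

  above-start : ∀ {T U s} (p : Path T U s) {x} → x < value g T → All (λ V → x < value g V) (vertices p)
  above-start [ _ ]         x<T = x<T ∷ []
  above-start (_ ∷⟨ lt ⟩ p) x<T = x<T ∷ above-start p (<-trans x<T lt)

  vertices-distinct : ∀ {T U s} (p : Path T U s) →
    AllPairs (λ V W → value g V ≢ value g W) (vertices p)
  vertices-distinct [ _ ]          = [] ∷ []
  vertices-distinct (_ ∷⟨ lt ⟩ p) = All.map <⇒≢ (above-start p lt) ∷ vertices-distinct p

  -- The surplus of the number of steps over the rise in rank, written additively to avoid truncated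
  -- subtraction.
  Gain : Triple → Triple → ℕ → Set
  Gain T U e = ∃ λ s → Path T U s × rank U + e ≤ rank T + s

  -- A path with `s` steps has `suc s` vertices, all with different values, so `s < N`.
  AtMost⇒Gain< : ∀ {T U N e} → AtMost g n N → Gain T U e → rank U + e < rank T + N
  AtMost⇒Gain< {T} few (s , p , le) = ≤-<-trans le (+-monoʳ-< (rank T)
    (subst (_≤ _) (vertices-length p) (few (vertices p) (vertices-valid p) (vertices-distinct p))))

  infixr 5 _⊕_
  -- Paths concatenate at `U` and the rank differences telescope, so the surpluses add.
  _⊕_ : ∀ {T U V e f} → Gain T U e → Gain U V f → Gain T V (e + f)
  _⊕_ {T} {U} {V} {e} {f} (s , p , le) (t , q , le') = s + t , p ⊙ q , (begin
    rank V + (e + f)    ≡⟨ shuffle (rank V) e f ⟩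
    (rank V + f) + e    ≤⟨ +-monoˡ-≤ e le' ⟩
    (rank U + t) + e    ≡⟨ swap (rank U) t e ⟩
    (rank U + e) + t    ≤⟨ +-monoˡ-≤ t le ⟩
    (rank T + s) + t    ≡⟨ +-assoc (rank T) s t ⟩
    rank T + (s + t)    ∎)
    where
    open ≤-Reasoning
    shuffle : ∀ x y z → x + (y + z) ≡ (x + z) + y
    shuffle = solve-∀
    swap : ∀ x y z → (x + y) + z ≡ (x + z) + y
    swap = solve-∀

  point-step : ∀ i → point g i < point g (suc i)
  point-step i = m<m+n (point g i) (g>0 i)

  raise₁ : ∀ t {i j l} → Valid n (t + i , j , l) → Gain (i , j , l) (t + i , j , l) 0
  raise₁ zero    v = 0 , [ v ] , ≤-refl
  raise₁ (suc t) {i} {j} {l} v@(lt , v') =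
    raise₁ t (<⇒≤ lt , v') ⊕ (1 , (<⇒≤ lt , v') ∷⟨ +-monoˡ-< _ (+-monoˡ-< _ (point-step (t + i))) ⟩ [ v ] ,
    ≤-reflexive (arith (t + i) j l))
    where
    arith : ∀ i j l → suc i + j + l + 0 ≡ i + j + l + 1
    arith = solve-∀

  raise₂ : ∀ t {i j l} → i < j → Valid n (i , t + j , l) → Gain (i , j , l) (i , t + j , l) 0
  raise₂ zero    _   v = 0 , [ v ] , ≤-refl
  raise₂ (suc t) {i} {j} {l} i<j v@(_ , lt , l≤n) =
    raise₂ t i<j v' ⊕ (1 , v' ∷⟨ +-monoˡ-< (point g l) (+-monoʳ-< (point g i) (point-step (t + j))) ⟩ [ v ] ,
    ≤-reflexive (arith i (t + j) l))
    where
    v' = ≤-trans i<j (m≤n+m j t) , <⇒≤ lt , l≤n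
    arith : ∀ i j l → i + suc j + l + 0 ≡ i + j + l + 1
    arith = solve-∀

  raise₃ : ∀ t {i j l} → i < j → j < l → t + l ≤ n → Gain (i , j , l) (i , j , t + l) 0
  raise₃ zero    i<j j<l l≤n = 0 , [ i<j , j<l , l≤n ] , ≤-refl
  raise₃ (suc t) {i} {j} {l} i<j j<l le =
    raise₃ t i<j j<l (<⇒≤ le) ⊕
    (1 , (i<j , j<t+l , <⇒≤ le) ∷⟨ +-monoʳ-< (point g i + point g j) (point-step (t + l)) ⟩
         [ i<j , m≤n⇒m≤1+n j<t+l , le ] ,
    ≤-reflexive (arith i j (t + l)))
    where
    j<t+l = ≤-trans j<l (m≤n+m l t)
    arith : ∀ i j l → i + j + suc l + 0 ≡ i + j + l + 1
    arith = solve-∀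

  -- Raising the top index first, then the middle one, then the lowest keeps the three indices
  -- strictly increasing throughout.
  climb : ∀ {T U} → Valid n T → Valid n U → T ≼ U → Gain T U 0
  climb {i , j , l} {i' , j' , l'} (i<j , j<l , _) (i'<j' , j'<l' , l'≤n) (i≤ , j≤ , l≤)
    with m≤n⇒∃[o]m+o≡n i≤ | m≤n⇒∃[o]m+o≡n j≤ | m≤n⇒∃[o]m+o≡n l≤
  ... | r , refl | s , refl | t , refl rewrite +-comm i r | +-comm j s | +-comm l t =
    raise₃ t i<j j<l l'≤n ⊕
    raise₂ s i<j (≤-trans i<j (m≤n+m j s) , j'<l' , l'≤n) ⊕
    raise₁ r (i'<j' , j'<l' , l'≤n)

  -- If the two middle vertices of a square have different sums, one more sum
  -- fits between the bottom and the top than the ranks account for.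
  square : ∀ {T X Y U} → Valid n T → Valid n X → Valid n Y → Valid n U →
    rank U ≡ 2 + rank T →
    value g T < value g X → value g T < value g Y → value g X < value g U → value g Y < value g U →
    value g X ≢ value g Y → Gain T U 1
  square {T} {X} {Y} {U} vT vX vY vU rk T<X T<Y X<U Y<U X≢Y with <-cmp (value g X) (value g Y)
  ... | tri< lt _ _ = 3 , vT ∷⟨ T<X ⟩ vX ∷⟨ lt ⟩ vY ∷⟨ Y<U ⟩ [ vU ] , ≤-reflexive (trans (cong (_+ 1) rk) (arith (rank T)))
    where
    arith : ∀ r → 2 + r + 1 ≡ r + 3
    arith = solve-∀
  ... | tri≈ _ eq _ = contradiction eq X≢Y
  ... | tri> _ _ gt = 3 , vT ∷⟨ T<Y ⟩ vY ∷⟨ gt ⟩ vX ∷⟨ X<U ⟩ [ vU ] , ≤-reflexive (trans (cong (_+ 1) rk) (arith (rank T)))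
    where
    arith : ∀ r → 2 + r + 1 ≡ r + 3
    arith = solve-∀

  -- The two middle vertices exceed the bottom of the square by `g i` and `g j` respectively. The
  -- distances `suc i < j` and `suc j < l` make both orders of raising valid.
  flip₁₂ : ∀ {i j l} → suc i < j → suc j < l → l ≤ n → g i ≢ g j → Gain (i , j , l) (suc i , suc j , l) 1
  flip₁₂ {i} {j} {l} i+1<j j+1<l l≤n gi≢gj =
    square (<⇒≤ i+1<j , <⇒≤ j+1<l , l≤n) (i+1<j , <⇒≤ j+1<l , l≤n)
      (m≤n⇒m≤1+n (<⇒≤ i+1<j) , j+1<l , l≤n) (m≤n⇒m≤1+n i+1<j , j+1<l , l≤n)
      (rk i j l)
      (+-monoˡ-< c (+-monoˡ-< b (point-step i)))
      (+-monoˡ-< c (+-monoʳ-< a (point-step j)))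
      (+-monoˡ-< c (+-monoʳ-< (a + g i) (point-step j)))
      (+-monoˡ-< c (+-monoˡ-< (b + g j) (point-step i)))
      (λ eq → gi≢gj (+-cancelˡ-≡ (a + b + c) _ _ (trans (sym (e₁ a b c (g i))) (trans eq (e₂ a b c (g j))))))
    where
    a = point g i
    b = point g j
    c = point g l
    rk : ∀ i j l → suc i + suc j + l ≡ 2 + (i + j + l)
    rk = solve-∀
    e₁ : ∀ a b c x → a + x + b + c ≡ a + b + c + x
    e₁ = solve-∀
    e₂ : ∀ a b c x → a + (b + x) + c ≡ a + b + c + x
    e₂ = solve-∀

  flip₁₃ : ∀ {i j l} → suc i < j → j < l → suc l ≤ n → g i ≢ g l → Gain (i , j , l) (suc i , j , suc l) 1
  flip₁₃ {i} {j} {l} i+1<j j<l l<n gi≢gl =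
    square (<⇒≤ i+1<j , j<l , <⇒≤ l<n) (i+1<j , j<l , <⇒≤ l<n)
      (<⇒≤ i+1<j , m≤n⇒m≤1+n j<l , l<n) (i+1<j , m≤n⇒m≤1+n j<l , l<n)
      (rk i j l)
      (+-monoˡ-< c (+-monoˡ-< b (point-step i)))
      (+-monoʳ-< (a + b) (point-step l))
      (+-monoʳ-< (a + g i + b) (point-step l))
      (+-monoˡ-< (c + g l) (+-monoˡ-< b (point-step i)))
      (λ eq → gi≢gl (+-cancelˡ-≡ (a + b + c) _ _ (trans (sym (e₁ a b c (g i))) (trans eq (e₂ a b c (g l))))))
    where
    a = point g i
    b = point g j
    c = point g l
    rk : ∀ i j l → suc i + j + suc l ≡ 2 + (i + j + l)
    rk = solve-∀
    e₁ : ∀ a b c x → a + x + b + c ≡ a + b + c + x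
    e₁ = solve-∀
    e₂ : ∀ a b c x → a + b + (c + x) ≡ a + b + c + x
    e₂ = solve-∀

  flip₂₃ : ∀ {i j l} → i < j → suc j < l → suc l ≤ n → g j ≢ g l → Gain (i , j , l) (i , suc j , suc l) 1
  flip₂₃ {i} {j} {l} i<j j+1<l l<n gj≢gl =
    square (i<j , <⇒≤ j+1<l , <⇒≤ l<n) (m≤n⇒m≤1+n i<j , j+1<l , <⇒≤ l<n)
      (i<j , m≤n⇒m≤1+n (<⇒≤ j+1<l) , l<n) (m≤n⇒m≤1+n i<j , m≤n⇒m≤1+n j+1<l , l<n)
      (rk i j l)
      (+-monoˡ-< c (+-monoʳ-< a (point-step j)))
      (+-monoʳ-< (a + b) (point-step l))
      (+-monoʳ-< (a + (b + g j)) (point-step l))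
      (+-monoˡ-< (c + g l) (+-monoʳ-< a (point-step j)))
      (λ eq → gj≢gl (+-cancelˡ-≡ (a + b + c) _ _ (trans (sym (e₁ a b c (g j))) (trans eq (e₂ a b c (g l))))))
    where
    a = point g i
    b = point g j
    c = point g l
    rk : ∀ i j l → i + suc j + suc l ≡ 2 + (i + j + l)
    rk = solve-∀
    e₁ : ∀ a b c x → a + (b + x) + c ≡ a + b + c + x
    e₁ = solve-∀
    e₂ : ∀ a b c x → a + b + (c + x) ≡ a + b + c + x
    e₂ = solve-∀

-- Reflection: reading the gaps from the other end

-- For i ≥ n this is the junk value g 0, so mirroring keeps all gaps positive.
mirror : ℕ → (ℕ → ℕ) → ℕ → ℕ
mirror n g i = g (n ∸ suc i)

point-mirror : ∀ n g i → i ≤ n → point (mirror n g) i + point g (n ∸ i) ≡ point g n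
point-mirror n g zero    _   = refl
point-mirror n g (suc i) i<n = begin
  point (mirror n g) i + g (n ∸ suc i) + point g (n ∸ suc i)   ≡⟨ arith (point (mirror n g) i) _ _ ⟩
  point (mirror n g) i + point g (suc (n ∸ suc i))             ≡⟨ cong (λ t → point (mirror n g) i + point g t) (sym (+-∸-assoc 1 i<n)) ⟩
  point (mirror n g) i + point g (n ∸ i)                       ≡⟨ point-mirror n g i (<⇒≤ i<n) ⟩
  point g n                                                    ∎
  where
  open ≡-Reasoning
  arith : ∀ x y z → x + y + z ≡ x + (z + y)
  arith = solve-∀

reflect : ℕ → Triple → Triple
reflect n (i , j , l) = n ∸ l , n ∸ j , n ∸ i

reflect-valid : ∀ {n T} → Valid n T → Valid n (reflect n T)
reflect-valid {n} {i , j , l} (i<j , j<l , l≤n) =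
  ∸-monoʳ-< j<l l≤n , ∸-monoʳ-< i<j (≤-trans (<⇒≤ j<l) l≤n) , m∸n≤m n i

rank-reflect : ∀ {n T} → Valid n T → rank (reflect n T) + rank T ≡ n + n + n
rank-reflect {n} {i , j , l} (i<j , j<l , l≤n) = trans (arith (n ∸ l) (n ∸ j) (n ∸ i) i j l)
  (cong₂ _+_ (cong₂ _+_ (m∸n+n≡m l≤n) (m∸n+n≡m j≤n)) (m∸n+n≡m (≤-trans (<⇒≤ i<j) j≤n)))
  where
  j≤n = ≤-trans (<⇒≤ j<l) l≤n
  arith : ∀ a b c i j l → a + b + c + (i + j + l) ≡ (a + l) + (b + j) + (c + i)
  arith = solve-∀

-- The mirrored gaps describe the set with each element subtracted from the greatest one, so a sum
-- of three is subtracted from three times that element.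
value-reflect : ∀ {n T} g → Valid n T →
  value g (reflect n T) + value (mirror n g) T ≡ point g n + point g n + point g n
value-reflect {n} {i , j , l} g (i<j , j<l , l≤n) =
  trans (arith (point g (n ∸ l)) (point g (n ∸ j)) (point g (n ∸ i)) (h i) (h j) (h l))
  (cong₂ _+_ (cong₂ _+_ (point-mirror n g l l≤n) (point-mirror n g j j≤n))
             (point-mirror n g i (≤-trans (<⇒≤ i<j) j≤n)))
  where
  h = point (mirror n g)
  j≤n = ≤-trans (<⇒≤ j<l) l≤n
  arith : ∀ a b c i j l → a + b + c + (i + j + l) ≡ (l + a) + (j + b) + (i + c)
  arith = solve-∀

module _ (g : ℕ → ℕ) (g>0 : ∀ i → 0 < g i) (n : ℕ) where
  private
    module F = Paths g g>0 n
    module B = Paths (mirror n g) (λ i → g>0 (n ∸ suc i)) n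

  path-start : ∀ {T U s} → B.Path T U s → Valid n T
  path-start B.[ v ] = v
  path-start (v B.∷⟨ _ ⟩ _) = v

  path-end : ∀ {T U s} → B.Path T U s → Valid n U
  path-end B.[ v ] = v
  path-end (_ B.∷⟨ _ ⟩ p) = path-end p

  reflect-anti : ∀ {T U} → Valid n T → Valid n U → value (mirror n g) T < value (mirror n g) U →
    value g (reflect n U) < value g (reflect n T)
  reflect-anti {T} {U} vT vU lt = +-cancelʳ-< (value (mirror n g) T) _ _ (begin-strict
    value g (reflect n U) + value (mirror n g) T  <⟨ +-monoʳ-< (value g (reflect n U)) lt ⟩
    value g (reflect n U) + value (mirror n g) U  ≡⟨ value-reflect g vU ⟩
    point g n + point g n + point g n             ≡⟨ sym (value-reflect g vT) ⟩
    value g (reflect n T) + value (mirror n g) T  ∎)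
    where open ≤-Reasoning

  -- Reflection reverses the order of the sums, so the path has to be turned back to front; `q`
  -- accumulates the part already reversed.
  reflect-path : ∀ {T U W s t} → B.Path T U s → F.Path (reflect n T) W t → F.Path (reflect n U) W (s + t)
  reflect-path B.[ _ ] q = q
  reflect-path {s = suc s} {t} (v B.∷⟨ lt ⟩ p) q = subst (F.Path _ _) (+-suc s t)
    (reflect-path p (reflect-valid (path-start p) F.∷⟨ reflect-anti v (path-start p) lt ⟩ q))

  -- A valid triple and its reflection have ranks adding up to `n + n + n`, so the rise in rank is
  -- the same after reversal, and so is the number of steps.
  reflect-gain : ∀ {T U e} → B.Gain T U e → F.Gain (reflect n U) (reflect n T) e
  reflect-gain {T} {U} {e} (s , p , le) = s ,
    subst (F.Path _ _) (+-identityʳ s) (reflect-path p F.[ reflect-valid (path-start p) ]) ,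
    +-cancelʳ-≤ (rank U) _ _ (begin
      rank (reflect n T) + e + rank U      ≡⟨ arith₁ (rank (reflect n T)) e (rank U) ⟩
      rank (reflect n T) + (rank U + e)    ≤⟨ +-monoʳ-≤ (rank (reflect n T)) le ⟩
      rank (reflect n T) + (rank T + s)    ≡⟨ sym (+-assoc (rank (reflect n T)) (rank T) s) ⟩
      rank (reflect n T) + rank T + s      ≡⟨ cong (_+ s) (trans (rank-reflect (path-start p)) (sym (rank-reflect (path-end p)))) ⟩
      rank (reflect n U) + rank U + s      ≡⟨ arith₂ (rank (reflect n U)) (rank U) s ⟩
      rank (reflect n U) + s + rank U      ∎)
    where
    open ≤-Reasoning
    arith₁ : ∀ x y z → x + y + z ≡ x + (z + y)
    arith₁ = solve-∀
    arith₂ : ∀ x y z → x + y + z ≡ x + z + y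
    arith₂ = solve-∀

-- Chains certified by evaluation on affine forms

-- (c , a , b) stands for the affine form c + a x + b y in x y : ℕ; as x and y are
-- nonnegative, coefficientwise comparison implies the inequality.
Form : Set
Form = ℕ × ℕ × ℕ

⟦_⟧ : Form → ℕ → ℕ → ℕ
⟦ c , a , b ⟧ x y = c + a * x + b * y

_⊞_ : Form → Form → Form
(c , a , b) ⊞ (c' , a' , b') = c + c' , a + a' , b + b'

_≺ᵇ_ : Form → Form → Bool
(c , a , b) ≺ᵇ (c' , a' , b') = (c <ᵇ c') ∧ ((a ≤ᵇ a') ∧ (b ≤ᵇ b'))

⊞-correct : ∀ P Q x y → ⟦ P ⊞ Q ⟧ x y ≡ ⟦ P ⟧ x y + ⟦ Q ⟧ x y
⊞-correct (c , a , b) (c' , a' , b') = arith c a b c' a' b'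
  where
  arith : ∀ c a b c' a' b' x y → c + c' + (a + a') * x + (b + b') * y ≡ c + a * x + b * y + (c' + a' * x + b' * y)
  arith = solve-∀

T-∧⁻ : ∀ {a b} → T (a ∧ b) → T a × T b
T-∧⁻ = Equivalence.to T-∧

≺ᵇ-correct : ∀ P Q x y → T (P ≺ᵇ Q) → ⟦ P ⟧ x y < ⟦ Q ⟧ x y
≺ᵇ-correct (c , a , b) (c' , a' , b') x y t with T-∧⁻ t
... | t₁ , t₂₃ with T-∧⁻ t₂₃
... | t₂ , t₃ = +-mono-<-≤ (+-mono-<-≤ (<ᵇ⇒< c c' t₁) (*-monoˡ-≤ x (≤ᵇ⇒≤ a a' t₂))) (*-monoˡ-≤ y (≤ᵇ⇒≤ b b' t₃))

pointF : (ℕ → Form) → ℕ → Form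
pointF G zero    = 0 , 0 , 0
pointF G (suc i) = pointF G i ⊞ G i

valueF : (ℕ → Form) → Triple → Form
valueF G (i , j , l) = (pointF G i ⊞ pointF G j) ⊞ pointF G l

-- The bound 6 is chosen because only the first six gaps are given as forms; validity below `6 + m`
-- then follows for every `m`.
valid₆ : Triple → Bool
valid₆ (i , j , l) = (i <ᵇ j) ∧ ((j <ᵇ l) ∧ (l ≤ᵇ 6))

ascending : (ℕ → Form) → Triple → List Triple → Bool
ascending G T []       = valid₆ T
ascending G T (U ∷ Us) = valid₆ T ∧ ((valueF G T ≺ᵇ valueF G U) ∧ ascending G U Us)

lastOf : Triple → List Triple → Triple
lastOf T []       = T
lastOf T (U ∷ Us) = lastOf U Us

valid₆-correct : ∀ m V → T (valid₆ V) → Valid (6 + m) V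
valid₆-correct m (i , j , l) t with T-∧⁻ t
... | t₁ , t₂₃ with T-∧⁻ t₂₃
... | t₂ , t₃ = <ᵇ⇒< i j t₁ , <ᵇ⇒< j l t₂ , ≤-trans (≤ᵇ⇒≤ l 6 t₃) (m≤m+n 6 m)

-- Sums computed on forms evaluate to the actual sums, so one Boolean check orders the listed sums
-- for all `x` and `y` at once.
module Explicit (g : ℕ → ℕ) (G : ℕ → Form) (x y : ℕ) (gaps : ∀ i → i < 6 → g i ≡ ⟦ G i ⟧ x y) where

  point-form : ∀ i → i ≤ 6 → point g i ≡ ⟦ pointF G i ⟧ x y
  point-form zero    _   = refl
  point-form (suc i) i<6 =
    trans (cong₂ _+_ (point-form i (<⇒≤ i<6)) (gaps i i<6)) (sym (⊞-correct (pointF G i) (G i) x y))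

  value-form : ∀ V → T (valid₆ V) → value g V ≡ ⟦ valueF G V ⟧ x y
  value-form (i , j , l) t with valid₆-correct 0 (i , j , l) t
  ... | i<j , j<l , l≤6 = sym (trans (⊞-correct (pointF G i ⊞ pointF G j) (pointF G l) x y)
    (cong₂ _+_ (trans (⊞-correct (pointF G i) (pointF G j) x y)
      (cong₂ _+_ (sym (point-form i (≤-trans (<⇒≤ i<j) j≤6))) (sym (point-form j j≤6))))
      (sym (point-form l l≤6))))
    where j≤6 = ≤-trans (<⇒≤ j<l) l≤6

  ascending-head : ∀ V Us → T (ascending G V Us) → T (valid₆ V)
  ascending-head V []      t = t
  ascending-head V (_ ∷ _) t = proj₁ (T-∧⁻ t)

  module _ (g>0 : ∀ i → 0 < g i) (m : ℕ) where
    open Paths g g>0 (6 + m)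

    ascending-path : ∀ V Us → T (ascending G V Us) → Path V (lastOf V Us) (length Us)
    ascending-path V []       t = [ valid₆-correct m V t ]
    ascending-path V (U ∷ Us) t with T-∧⁻ t
    ... | t₁ , t₂₃ with T-∧⁻ t₂₃
    ... | t₂ , t₃ = valid₆-correct m V t₁ ∷⟨ subst₂ _<_ (sym (value-form V t₁)) (sym (value-form U (ascending-head U Us t₃)))
                       (≺ᵇ-correct (valueF G V) (valueF G U) x y t₂) ⟩ ascending-path U Us t₃

-- The cost of an exceptional gap near an end

profile : ℕ → Form → Form → ℕ → Form
profile p A D i = if i ≡ᵇ p then A else D

-- Both ends are analysed below hub.  Since n ≥ 11, hub lies below its own mirror image,
-- so the gains of the two ends fit into one chain.
start hub : Triple
start = 0 , 1 , 2
hub   = 3 , 5 , 6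

_≼ᵇ_ : Triple → Triple → Bool
(i , j , l) ≼ᵇ (i' , j' , l') = (i ≤ᵇ i') ∧ ((j ≤ᵇ j') ∧ (l ≤ᵇ l'))

≼ᵇ-correct : ∀ V W → T (V ≼ᵇ W) → V ≼ W
≼ᵇ-correct (i , j , l) (i' , j' , l') t with T-∧⁻ t
... | t₁ , t₂₃ with T-∧⁻ t₂₃
... | t₂ , t₃ = ≤ᵇ⇒≤ i i' t₁ , ≤ᵇ⇒≤ j j' t₂ , ≤ᵇ⇒≤ l l' t₃

-- The 3 is the rank of `start`. The listed chain may stop anywhere below `hub`, since `climb`
-- completes it without loss.
certifies : (ℕ → Form) → ℕ → List Triple → Bool
certifies G e Us = ascending G start Us ∧
  ((valid₆ (lastOf start Us) ∧ (lastOf start Us ≼ᵇ hub)) ∧ (rank (lastOf start Us) + e ≤ᵇ 3 + length Us))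

-- Bump p c e: gap number p from the end is c d instead of d, which costs e gains.
data Bump : ℕ → ℕ → ℕ → Set where
  first-double  : Bump 0 2 1
  first-triple  : Bump 0 3 2
  second-double : Bump 1 2 2
  third-double  : Bump 2 2 2

-- The index is the number of gains that the shape forces; at most one of the three outermost gaps
-- deviates from `d`.
data EndShape (g : ℕ → ℕ) (d : ℕ) : ℕ → Set where
  flat : (∀ i → i < 3 → g i ≡ d) → EndShape g d 0
  bump : ∀ {p c e} → Bump p c e → g p ≡ c * d → (∀ i → i < 3 → i ≢ p → g i ≡ d) → EndShape g d e

-- For closed inequalities the implicit argument reduces to the unit type and is filled in
-- automatically.
auto : ∀ {a b} {t : T (a ≤ᵇ b)} → a ≤ b
auto {a} {b} {t} = ≤ᵇ⇒≤ a b t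

below-3 : ∀ {P : ℕ → Set} → P 0 → P 1 → P 2 → ∀ i → i < 3 → P i
below-3 p₀ p₁ p₂ 0 _ = p₀
below-3 p₀ p₁ p₂ 1 _ = p₁
below-3 p₀ p₁ p₂ 2 _ = p₂
below-3 p₀ p₁ p₂ (suc (suc (suc i))) (s≤s (s≤s (s≤s ())))

-- The slacks x, y of the two inequalities are coordinates in which a and d are affine forms.
between : ∀ {a d} c → c * d < a → a < suc c * d →
  ∃ λ x → ∃ λ y → a ≡ suc (c * (2 + x + y)) + x × d ≡ 2 + x + y
between {a} {d} c lo hi with m≤n⇒∃[o]m+o≡n lo | m≤n⇒∃[o]m+o≡n hi
... | x , refl | y , eq = x , y , cong (λ t → suc (c * t) + x) d≡ , d≡
  where
  arith : ∀ z x y → z + (2 + x + y) ≡ suc (suc (z + x) + y)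
  arith = solve-∀
  d≡ : d ≡ 2 + x + y
  d≡ = +-cancelˡ-≡ (c * d) d (2 + x + y) (sym (trans (arith (c * d) x y) (trans eq (+-comm d (c * d)))))

module LeftEnd (m : ℕ) (g : ℕ → ℕ) (g>0 : ∀ i → 0 < g i) (d : ℕ)
  (g₃ : g 3 ≡ d) (g₄ : g 4 ≡ d) (g₅ : g 5 ≡ d) where

  open Paths g g>0 (6 + m)

  climb₆ : ∀ V W {t : T (valid₆ V ∧ (valid₆ W ∧ (V ≼ᵇ W)))} → Gain V W 0
  climb₆ V W {t} with T-∧⁻ t
  ... | t₁ , t₂₃ with T-∧⁻ t₂₃
  ... | t₂ , t₃ = climb (valid₆-correct m V t₁) (valid₆-correct m W t₂) (≼ᵇ-correct V W t₃)

  0<d : 0 < d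
  0<d = subst (0 <_) g₃ (g>0 3)

  ≢g₃ : ∀ {x} → x ≢ d → x ≢ g 3
  ≢g₃ ne = ne ∘ (λ eq → trans eq g₃)

  ≢g₄ : ∀ {x} → x ≢ d → x ≢ g 4
  ≢g₄ ne = ne ∘ (λ eq → trans eq g₄)

  ≢g₅ : ∀ {x} → x ≢ d → x ≢ g 5
  ≢g₅ ne = ne ∘ (λ eq → trans eq g₅)

  -- From `start` on, gap 0 is crossed by the lowest index alone, which gives one flip. Gaps 1 and 2
  -- are also crossed by the middle index, so `gain₁` and `gain₂` flip them twice.
  gain₀ : g 0 ≢ d → Gain start hub 1
  gain₀ ne = climb₆ start (0 , 3 , 5) ⊕ flip₁₂ auto auto auto (≢g₃ ne) ⊕ climb₆ (1 , 4 , 5) hub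

  gain₁ : g 1 ≢ d → Gain start hub 2
  gain₁ ne = climb₆ start (0 , 1 , 3) ⊕ flip₂₃ auto auto auto (≢g₃ ne) ⊕ climb₆ (0 , 2 , 4) (1 , 3 , 5)
    ⊕ flip₁₂ auto auto auto (≢g₃ ne) ⊕ climb₆ (2 , 4 , 5) hub

  gain₂ : g 2 ≢ d → Gain start hub 2
  gain₂ ne = climb₆ start (0 , 2 , 4) ⊕ flip₂₃ auto auto auto (≢g₄ ne) ⊕ climb₆ (0 , 3 , 5) (2 , 4 , 6)
    ⊕ flip₁₂ auto auto auto (≢g₄ ne)

  -- With two deviating gaps, three flips fit on one chain, each against one of the gaps 3, 4, 5.
  -- Hence the sizes of the deviating gaps do not matter here and in the next two lemmas.
  gain₀₁ : g 0 ≢ d → g 1 ≢ d → Gain start hub 3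
  gain₀₁ ne₀ ne₁ = climb₆ start (0 , 1 , 3) ⊕ flip₂₃ auto auto auto (≢g₃ ne₁) ⊕ climb₆ (0 , 2 , 4) (0 , 3 , 5)
    ⊕ flip₁₂ auto auto auto (≢g₃ ne₀) ⊕ flip₁₃ auto auto auto (≢g₅ ne₁) ⊕ climb₆ (2 , 4 , 6) hub

  gain₀₂ : g 0 ≢ d → g 2 ≢ d → Gain start hub 3
  gain₀₂ ne₀ ne₂ = climb₆ start (0 , 2 , 4) ⊕ flip₂₃ auto auto auto (≢g₄ ne₂)
    ⊕ flip₁₂ auto auto auto (≢g₃ ne₀) ⊕ climb₆ (1 , 4 , 5) (2 , 4 , 6) ⊕ flip₁₂ auto auto auto (≢g₄ ne₂)

  gain₁₂ : g 1 ≢ d → g 2 ≢ d → Gain start hub 3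
  gain₁₂ ne₁ ne₂ = climb₆ start (0 , 1 , 3) ⊕ flip₂₃ auto auto auto (≢g₃ ne₁)
    ⊕ flip₂₃ auto auto auto (≢g₄ ne₂) ⊕ climb₆ (0 , 3 , 5) (1 , 3 , 5)
    ⊕ flip₁₂ auto auto auto (≢g₃ ne₁) ⊕ climb₆ (2 , 4 , 5) hub

  -- With `p` as the only possible exception among the first six gaps, all sums below `hub` are
  -- combinations of `g p` and `d`, and their order depends only on how these two compare.
  module Single (p : ℕ) (others : ∀ i → i < 3 → i ≢ p → g i ≡ d) where

    others₆ : ∀ i → i < 6 → i ≢ p → g i ≡ d
    others₆ 0 _ = others 0 auto
    others₆ 1 _ = others 1 auto
    others₆ 2 _ = others 2 auto
    others₆ 3 _ _ = g₃
    others₆ 4 _ _ = g₄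
    others₆ 5 _ _ = g₅
    others₆ (suc (suc (suc (suc (suc (suc i)))))) (s≤s (s≤s (s≤s (s≤s (s≤s (s≤s ()))))))

    certified : ∀ A D x y → g p ≡ ⟦ A ⟧ x y → d ≡ ⟦ D ⟧ x y → ∀ e Us {t : T (certifies (profile p A D) e Us)} →
      Gain start hub e
    certified A D x y gp≡ d≡ e Us {t} with T-∧⁻ t
    ... | t₁ , t₂₃ with T-∧⁻ t₂₃
    ... | t₂ , t₃ with T-∧⁻ t₂
    ... | t₄ , t₅ = subst (Gain start hub) (+-identityʳ e) (gain ⊕
      climb (valid₆-correct m _ t₄) (valid₆-correct m hub tt) (≼ᵇ-correct (lastOf start Us) hub t₅))
      where
      gaps : ∀ i → i < 6 → g i ≡ ⟦ profile p A D i ⟧ x y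
      gaps i i<6 with i ≡ᵇ p in eq
      ... | true  = trans (cong g (≡ᵇ⇒≡ i p (subst T (sym eq) tt))) gp≡
      ... | false = trans (others₆ i i<6 (λ i≡p → subst T eq (≡⇒≡ᵇ i p i≡p))) d≡
      gain : Gain start (lastOf start Us) e
      gain = length Us , Explicit.ascending-path g (profile p A D) x y gaps g>0 m start Us t₁ ,
        ≤ᵇ⇒≤ (rank (lastOf start Us) + e) (3 + length Us) t₃

    module _ (a<d : g p < d) where
      private
        x = proj₁ (m≤n⇒∃[o]m+o≡n a<d)
        y = proj₁ (m≤n⇒∃[o]m+o≡n (g>0 p))
        a≡ : suc y ≡ g p
        a≡ = proj₂ (m≤n⇒∃[o]m+o≡n (g>0 p))
        d≡ : suc (g p) + x ≡ d
        d≡ = proj₂ (m≤n⇒∃[o]m+o≡n a<d)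
      -- The forms say `g p = 1 + y` and `d = 2 + x + y`, which parametrise `0 < g p < d`.
      below : ∀ e Us {t : T (certifies (profile p (1 , 0 , 1) (2 , 1 , 1)) e Us)} → Gain start hub e
      below e Us {t} = certified (1 , 0 , 1) (2 , 1 , 1) x y (trans (sym a≡) (arith₁ x y))
        (trans (sym d≡) (trans (cong (λ a → suc a + x) (sym a≡)) (arith₂ x y))) e Us {t}
        where
        arith₁ : ∀ x y → suc y ≡ 1 + 0 * x + 1 * y
        arith₁ = solve-∀
        arith₂ : ∀ x y → suc (suc y) + x ≡ 2 + 1 * x + 1 * y
        arith₂ = solve-∀

    module _ (lo : 1 * d < g p) (hi : g p < 2 * d) where
      one-two : ∀ e Us {t : T (certifies (profile p (3 , 2 , 1) (2 , 1 , 1)) e Us)} → Gain start hub e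
      one-two e Us {t} with between 1 lo hi
      ... | x , y , a≡ , d≡ = certified (3 , 2 , 1) (2 , 1 , 1) x y (trans a≡ (arith₁ x y)) (trans d≡ (arith₂ x y)) e Us {t}
        where
        arith₁ : ∀ x y → suc (1 * (2 + x + y)) + x ≡ 3 + 2 * x + 1 * y
        arith₁ = solve-∀
        arith₂ : ∀ x y → 2 + x + y ≡ 2 + 1 * x + 1 * y
        arith₂ = solve-∀

    module _ (lo : 2 * d < g p) (hi : g p < 3 * d) where
      two-three : ∀ e Us {t : T (certifies (profile p (5 , 3 , 2) (2 , 1 , 1)) e Us)} → Gain start hub e
      two-three e Us {t} with between 2 lo hi
      ... | x , y , a≡ , d≡ = certified (5 , 3 , 2) (2 , 1 , 1) x y (trans a≡ (arith₁ x y)) (trans d≡ (arith₂ x y)) e Us {t}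
        where
        arith₁ : ∀ x y → suc (2 * (2 + x + y)) + x ≡ 5 + 3 * x + 2 * y
        arith₁ = solve-∀
        arith₂ : ∀ x y → 2 + x + y ≡ 2 + 1 * x + 1 * y
        arith₂ = solve-∀

    module _ (c : ℕ) (c*d<a : c * d < g p) where
      -- Here `d = 1 + x` and `g p = c * d + 1 + y`, with no upper bound on `g p`.
      above : ∀ e Us {t : T (certifies (profile p (suc c , c , 1) (1 , 1 , 0)) e Us)} → Gain start hub e
      above e Us {t} with m≤n⇒∃[o]m+o≡n c*d<a | m≤n⇒∃[o]m+o≡n 0<d
      ... | y , a≡ | x , refl = certified (suc c , c , 1) (1 , 1 , 0) x y (trans (sym a≡) (arith₁ c x y)) (arith₂ x y) e Us {t}
        where
        arith₁ : ∀ c x y → suc (c * suc x) + y ≡ suc c + c * x + 1 * y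
        arith₁ = solve-∀
        arith₂ : ∀ x y → suc x ≡ 1 + 1 * x + 0 * y
        arith₂ = solve-∀

    exactly-three : g p ≡ 3 * d → ∀ e Us {t : T (certifies (profile p (3 , 3 , 0) (1 , 1 , 0)) e Us)} → Gain start hub e
    exactly-three a≡ e Us {t} with m≤n⇒∃[o]m+o≡n 0<d
    ... | x , refl = certified (3 , 3 , 0) (1 , 1 , 0) x 0 (trans a≡ (arith₁ x)) (arith₂ x) e Us {t}
      where
      arith₁ : ∀ x → 3 * suc x ≡ 3 + 3 * x + 0 * 0
      arith₁ = solve-∀
      arith₂ : ∀ x → suc x ≡ 1 + 1 * x + 0 * 0
      arith₂ = solve-∀

  -- Three gains already exceed what the whole chain allows; otherwise the shape is known and its
  -- cost is realised by a chain below `hub`.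
  Outcome : Set
  Outcome = Gain start hub 3 ⊎ ∃ λ e → EndShape g d e × Gain start hub e

  -- In each range of the exceptional gap relative to d, the listed triples have increasing
  -- sums; the list includes the sums that fall between those of the chain.
  module _ (others : ∀ i → i < 3 → i ≢ 0 → g i ≡ d) (ne : g 0 ≢ d) where
    open Single 0 others
    only-first : Outcome
    only-first with <-cmp (g 0) d
    ... | tri≈ _ eq _ = contradiction eq ne
    ... | tri< a<d _ _ = inj₁ (below a<d 3
      ((0 , 1 , 3) ∷ (0 , 1 , 4) ∷ (1 , 2 , 3) ∷ (0 , 2 , 4) ∷ (1 , 2 , 4) ∷ (0 , 2 , 5) ∷ (1 , 2 , 5) ∷ (0 , 3 , 5) ∷ (1 , 2 , 6) ∷ []))
    ... | tri> _ _ d<a with <-cmp (g 0) (2 * d)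
    ... | tri< a<2d _ _ = inj₁ (one-two (subst (_< g 0) (sym (*-identityˡ d)) d<a) a<2d 3
      ((0 , 1 , 3) ∷ (0 , 1 , 4) ∷ (0 , 2 , 4) ∷ (1 , 2 , 3) ∷ (0 , 2 , 5) ∷ (1 , 2 , 4) ∷ (0 , 3 , 5) ∷ (1 , 2 , 5) ∷ []))
    ... | tri≈ _ eq _ = inj₂ (1 , bump first-double eq others , gain₀ ne)
    ... | tri> _ _ 2d<a with <-cmp (g 0) (3 * d)
    ... | tri< a<3d _ _ = inj₁ (two-three 2d<a a<3d 3
      ((0 , 1 , 3) ∷ (0 , 1 , 4) ∷ (0 , 2 , 4) ∷ (0 , 2 , 5) ∷ (1 , 2 , 3) ∷ (0 , 3 , 5) ∷ (1 , 2 , 4) ∷ []))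
    ... | tri≈ _ eq _ = inj₂ (2 , bump first-triple eq others , exactly-three eq 2
      ((0 , 1 , 3) ∷ (0 , 1 , 4) ∷ (0 , 2 , 4) ∷ (0 , 2 , 5) ∷ (1 , 2 , 3) ∷ []))
    ... | tri> _ _ 3d<a = inj₁ (above 3 3d<a 3
      ((0 , 1 , 3) ∷ (0 , 1 , 4) ∷ (0 , 2 , 4) ∷ (0 , 2 , 5) ∷ (0 , 3 , 5) ∷ (1 , 2 , 3) ∷ []))

  module _ (others : ∀ i → i < 3 → i ≢ 1 → g i ≡ d) (ne : g 1 ≢ d) where
    open Single 1 others
    only-second : Outcome
    only-second with <-cmp (g 1) d
    ... | tri≈ _ eq _ = contradiction eq ne
    ... | tri< a<d _ _ = inj₁ (below a<d 3
      ((0 , 1 , 3) ∷ (0 , 2 , 3) ∷ (0 , 1 , 4) ∷ (1 , 2 , 3) ∷ (0 , 1 , 5) ∷ (1 , 2 , 4) ∷ (0 , 1 , 6) ∷ (1 , 2 , 5) ∷ []))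
    ... | tri> _ _ d<a with <-cmp (g 1) (2 * d)
    ... | tri< a<2d _ _ = inj₁ (one-two (subst (_< g 1) (sym (*-identityˡ d)) d<a) a<2d 3
      ((0 , 1 , 3) ∷ (0 , 1 , 4) ∷ (0 , 2 , 3) ∷ (0 , 1 , 5) ∷ (1 , 2 , 3) ∷ (0 , 1 , 6) ∷ (1 , 2 , 4) ∷ []))
    ... | tri≈ _ eq _ = inj₂ (2 , bump second-double eq others , gain₁ ne)
    ... | tri> _ _ 2d<a = inj₁ (above 2 2d<a 3
      ((0 , 1 , 3) ∷ (0 , 1 , 4) ∷ (0 , 1 , 5) ∷ (0 , 2 , 3) ∷ (1 , 2 , 3) ∷ (1 , 2 , 4) ∷ (1 , 2 , 5) ∷ (1 , 2 , 6) ∷ (1 , 3 , 6) ∷ (2 , 3 , 4) ∷ []))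

  module _ (others : ∀ i → i < 3 → i ≢ 2 → g i ≡ d) (ne : g 2 ≢ d) where
    open Single 2 others
    only-third : Outcome
    only-third with <-cmp (g 2) d
    ... | tri≈ _ eq _ = contradiction eq ne
    ... | tri< a<d _ _ = inj₁ (below a<d 3
      ((0 , 1 , 3) ∷ (0 , 2 , 3) ∷ (1 , 2 , 3) ∷ (0 , 3 , 4) ∷ (1 , 2 , 4) ∷ (1 , 3 , 4) ∷ (1 , 2 , 5) ∷ (2 , 3 , 4) ∷ (1 , 2 , 6) ∷ (2 , 3 , 5) ∷ []))
    ... | tri> _ _ d<a with <-cmp (g 2) (2 * d)
    ... | tri< a<2d _ _ = inj₁ (one-two (subst (_< g 2) (sym (*-identityˡ d)) d<a) a<2d 3
      ((0 , 1 , 3) ∷ (0 , 2 , 3) ∷ (1 , 2 , 3) ∷ (1 , 2 , 4) ∷ (0 , 3 , 4) ∷ (1 , 2 , 5) ∷ (1 , 3 , 4) ∷ (1 , 2 , 6) ∷ (2 , 3 , 4) ∷ []))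
    ... | tri≈ _ eq _ = inj₂ (2 , bump third-double eq others , gain₂ ne)
    ... | tri> _ _ 2d<a = inj₁ (above 2 2d<a 3
      ((0 , 1 , 3) ∷ (0 , 2 , 3) ∷ (1 , 2 , 3) ∷ (1 , 2 , 4) ∷ (1 , 2 , 5) ∷ (0 , 3 , 4) ∷ (1 , 3 , 4) ∷ (2 , 3 , 4) ∷ (2 , 3 , 5) ∷ (2 , 3 , 6) ∷ (2 , 4 , 6) ∷ (3 , 4 , 5) ∷ []))

  except : ∀ {p} → (∀ i → i < 3 → i ≡ p ⊎ g i ≡ d) → ∀ i → i < 3 → i ≢ p → g i ≡ d
  except h i i<3 i≢p with h i i<3
  ... | inj₁ i≡p = contradiction i≡p i≢p
  ... | inj₂ eq  = eq

  outcome : Outcome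
  outcome with g 0 ≟ d | g 1 ≟ d | g 2 ≟ d
  ... | yes e₀ | yes e₁ | yes e₂ = inj₂ (0 , flat (below-3 e₀ e₁ e₂) , climb₆ start hub)
  ... | no n₀  | yes e₁ | yes e₂ = only-first (except (below-3 (inj₁ refl) (inj₂ e₁) (inj₂ e₂))) n₀
  ... | yes e₀ | no n₁  | yes e₂ = only-second (except (below-3 (inj₂ e₀) (inj₁ refl) (inj₂ e₂))) n₁
  ... | yes e₀ | yes e₁ | no n₂  = only-third (except (below-3 (inj₂ e₀) (inj₂ e₁) (inj₁ refl))) n₂
  ... | no n₀  | no n₁  | _      = inj₁ (gain₀₁ n₀ n₁)
  ... | no n₀  | yes _  | no n₂  = inj₁ (gain₀₂ n₀ n₂)
  ... | yes _  | no n₁  | no n₂  = inj₁ (gain₁₂ n₁ n₂)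

-- Equal interior gaps and the combined cost of both ends

Steady : ℕ → (ℕ → ℕ) → ℕ → Set
Steady m g d = ∀ i → 3 ≤ i → i ≤ 2 + m → g i ≡ d

record Ends (m : ℕ) (g : ℕ → ℕ) : Set where
  field
    {d eˡ eʳ} : ℕ
    steady : Steady m g d
    leftEnd  : EndShape g d eˡ
    rightEnd : EndShape (mirror (6 + m) g) d eʳ
    excess : eˡ + eʳ ≤ 2

-- The greatest index is n = 6 + m, so k = 7 + m and 3k − 6 = 15 + 3m.
module Structure (m : ℕ) (5≤m : 5 ≤ m) (g : ℕ → ℕ) (g>0 : ∀ i → 0 < g i)
  (few : AtMost g (6 + m) (15 + 3 * m)) where

  open Paths g g>0 (6 + m)

  end : Triple
  end = reflect (6 + m) start

  end-valid : Valid (6 + m) end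
  end-valid = ≤-refl , ≤-refl , ≤-refl

  -- `start` has rank 3 and `end` has rank `15 + 3 * m`, so a chain with gain `e` shows at least
  -- `13 + 3 * m + e` sums, against at most `15 + 3 * m`.
  gain≤2 : ∀ {e} → Gain start end e → e ≤ 2
  gain≤2 {e} gn = +-cancelˡ-≤ (15 + 3 * m) e 2 (begin
    15 + 3 * m + e       ≡⟨ cong (_+ e) (arith m) ⟩
    rank end + e         ≤⟨ ≤-pred (AtMost⇒Gain< few gn) ⟩
    2 + (15 + 3 * m)     ≡⟨ +-comm 2 (15 + 3 * m) ⟩
    15 + 3 * m + 2       ∎)
    where
    open ≤-Reasoning
    arith : ∀ m → 15 + 3 * m ≡ 4 + m + (5 + m) + (6 + m)
    arith = solve-∀

  other : ∀ {a b} c → a ≢ b → c ≢ a ⊎ c ≢ b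
  other {a} c a≢b with c ≟ a
  ... | yes refl = inj₂ a≢b
  ... | no  c≢a  = inj₁ c≢a

  module _ (w : ℕ) (w+2≤m : 2 + w ≤ m) (ne : g 3 ≢ g (4 + w)) where

    private
      w≤m : w ≤ m
      w≤m = ≤-trans (m≤n+m w 2) w+2≤m
      1+w≤m : 1 + w ≤ m
      1+w≤m = ≤-trans (m≤n+m (1 + w) 1) w+2≤m
      up : ∀ {k l} {t : T (k ≤ᵇ l)} → k + w ≤ l + m
      up {k} {l} {t} = +-mono-≤ (≤ᵇ⇒≤ k l t) w≤m
      lit : ∀ {k l} {t : T (k ≤ᵇ l)} → k ≤ l + w
      lit {k} {l} {t} = ≤-trans (≤ᵇ⇒≤ k l t) (m≤m+n l w)

    -- Gaps 3 and 4 + w are used in each of the three roles of a flip; whatever the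
    -- partner gap is, it differs from one of the two.
    first-gain : Gain start (0 , 2 , 5 + w) 1
    first-gain with other (g 1) ne
    ... | inj₁ n₁ = climb (auto , auto , auto) (auto , auto , auto) (auto , auto , auto)
                  ⊕ flip₂₃ {0} {1} {3} auto auto auto n₁
                  ⊕ climb (auto , auto , auto) (auto , lit , up) (auto , auto , lit)
    ... | inj₂ n₁ = climb (auto , auto , auto) (auto , lit , up) (auto , auto , lit)
                  ⊕ flip₂₃ {0} {1} {4 + w} auto lit up n₁

    second-gain : Gain (0 , 2 , 5 + w) (1 , 5 + w , 6 + w) 1
    second-gain with other (g 0) ne
    ... | inj₁ n₀ = climb (auto , lit , up) (auto , lit , up) (auto , auto , n≤1+n _)
                  ⊕ flip₁₂ {0} {3} {6 + w} auto lit up n₀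
                  ⊕ climb (auto , lit , up) (lit , ≤-refl , up) (auto , lit , ≤-refl)
    ... | inj₂ n₀ = climb (auto , lit , up) (lit , n≤1+n _ , up) (auto , lit , n≤1+n _)
                  ⊕ flip₁₂ {0} {4 + w} {6 + w} lit ≤-refl up n₀

    third-gain : Gain (1 , 5 + w , 6 + w) (5 + w , 6 + w , 6 + m) 1
    third-gain with other (g (5 + m)) ne
    ... | inj₁ n₅ = climb (lit , ≤-refl , up) (lit , bound , n≤1+n _) (auto , n≤1+n _ , <⇒≤ bound)
                  ⊕ flip₁₃ {3} {6 + w} {5 + m} lit bound ≤-refl (n₅ ∘ sym)
                  ⊕ climb (lit , m≤n⇒m≤1+n bound , ≤-refl) (≤-refl , m≤n⇒m≤1+n bound , ≤-refl) (lit , ≤-refl , ≤-refl)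
      -- This is `6 + w < 5 + m`: the middle index stays below the last gap, which the top index
      -- crosses.
      where bound = +-monoʳ-≤ 5 w+2≤m
    ... | inj₂ n₅ = climb (lit , ≤-refl , up) (n≤1+n _ , bound , n≤1+n _) (lit , n≤1+n _ , <⇒≤ bound)
                  ⊕ flip₁₃ {4 + w} {6 + w} {5 + m} ≤-refl bound ≤-refl (n₅ ∘ sym)
      where bound = +-monoʳ-≤ 5 w+2≤m

    -- The three gains follow one another on a single chain from `start` to `end`, one more than
    -- `gain≤2` allows.
    interior-contradiction : ⊥
    interior-contradiction = 1+n≰n (gain≤2 (first-gain ⊕ second-gain ⊕ third-gain
      ⊕ climb (≤-refl , +-monoʳ-≤ 6 1+w≤m , ≤-refl) end-valid (+-monoʳ-≤ 4 1+w≤m , +-monoʳ-≤ 5 1+w≤m , ≤-refl)))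

  steady : Steady m g (g 3)
  steady i 3≤i i≤2+m with m≤n⇒∃[o]m+o≡n 3≤i
  ... | zero  , refl = refl
  ... | suc w , refl with g 3 ≟ g (4 + w)
  ... | yes eq = sym eq
  ... | no  ne = contradiction (≤-pred (≤-pred i≤2+m)) (λ le → interior-contradiction w le ne)

  private
    h = mirror (6 + m) g
    h>0 : ∀ i → 0 < h i
    h>0 i = g>0 (6 + m ∸ suc i)
    3≤m : 3 ≤ m
    3≤m = ≤-trans auto 5≤m
    module L = LeftEnd m g g>0 (g 3) refl
      (steady 4 auto (≤-trans auto (+-monoʳ-≤ 2 5≤m))) (steady 5 auto (≤-trans auto (+-monoʳ-≤ 2 5≤m)))
    -- The mirrored gaps 3, 4, 5 are the gaps `2 + m`, `1 + m`, `m`, which belong to the steady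
    -- range.
    module R = LeftEnd m h h>0 (g 3)
      (steady (2 + m) (≤-trans 3≤m (m≤n+m m 2)) ≤-refl)
      (steady (1 + m) (≤-trans 3≤m (m≤n+m m 1)) (n≤1+n _))
      (steady m 3≤m (m≤n+m m 2))

    hub-valid : Valid (6 + m) hub
    hub-valid = valid₆-correct m hub tt

  -- The mirror image of `hub` is `(m , 1 + m , 3 + m)`. The left chain, a climb between the two
  -- hubs and the reversed right chain form one chain, so the costs add.
  across : ∀ {e e'} → Gain start hub e → Paths.Gain h h>0 (6 + m) start hub e' → e + e' ≤ 2
  across gl gr = gain≤2 (gl ⊕ climb hub-valid (reflect-valid hub-valid)
    (3≤m , ≤-trans 5≤m (n≤1+n m) , ≤-trans auto (+-monoʳ-≤ 3 3≤m)) ⊕ reflect-gain g g>0 (6 + m) gr)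

  ends : Ends m g
  ends with L.outcome | R.outcome
  ... | inj₁ gl | inj₁ gr = contradiction (across gl gr) λ { (s≤s (s≤s ())) }
  ... | inj₁ gl | inj₂ (_ , _ , gr) = contradiction (across gl gr) λ { (s≤s (s≤s ())) }
  ... | inj₂ (e , _ , gl) | inj₁ gr = contradiction (≤-trans (m≤n+m 3 e) (across gl gr)) λ { (s≤s (s≤s ())) }
  ... | inj₂ (_ , sl , gl) | inj₂ (_ , sr , gr) = record
    { steady = steady ; leftEnd = sl ; rightEnd = sr ; excess = across gl gr }

  path-monotone : ∀ {V W s} → Path V W s → value g V ≤ value g W
  path-monotone [ _ ]          = ≤-refl
  path-monotone (_ ∷⟨ lt ⟩ p) = ≤-trans (<⇒≤ lt) (path-monotone p)

  -- Any valid triple lies componentwise between the lowest and the highest one, and climbing never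
  -- decreases the sum.
  value-bounds : ∀ V → Valid (6 + m) V → value g start ≤ value g V × value g V ≤ value g end
  value-bounds (i , j , l) v@(i<j , j<l , l≤n) =
    path-monotone (proj₁ (proj₂ (climb (valid₆-correct m start tt) v
      (z≤n , ≤-trans (s≤s z≤n) i<j , ≤-trans (s≤s (≤-trans (s≤s z≤n) i<j)) j<l)))) ,
    path-monotone (proj₁ (proj₂ (climb v end-valid
      (≤-pred (≤-trans i<j (≤-pred (≤-trans j<l l≤n))) , ≤-pred (≤-trans j<l l≤n) , l≤n))))

-- The last three gaps are addressed as `5 + m ∸ j`, the form in which the mirrored end delivers
-- them.
assemble : ∀ {m} {P : ℕ → Set} → (∀ i → i < 3 → P i) → (∀ i → 3 ≤ i → i ≤ 2 + m → P i) →
  (∀ j → j < 3 → P (5 + m ∸ j)) → ∀ i → i < 6 + m → P i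
assemble {m} {P} left middle right i i<n with i <? 3
... | yes i<3 = left i i<3
... | no  i≮3 with i ≤? 2 + m
... | yes i≤  = middle i (≮⇒≥ i≮3) i≤
... | no  i≰  with m≤n⇒∃[o]m+o≡n (≤-pred i<n)
... | j , i+j≡ = subst P (trans (cong (_∸ j) (sym i+j≡)) (m+n∸n≡m i j)) (right j j<3)
  where
  j<3 : j < 3
  j<3 = ≰⇒> λ 3≤j → i≰ (+-cancelˡ-≤ 3 i (2 + m) (≤-trans (+-monoˡ-≤ i 3≤j)
    (≤-reflexive (trans (+-comm j i) i+j≡))))

EndShape-∣ : ∀ {g d e} → EndShape g d e → ∀ i → i < 3 → d ∣ g i
EndShape-∣ (flat f)         i i<3 = ∣-reflexive (sym (f i i<3))
EndShape-∣ (bump {p} {c} _ eq f) i i<3 with i ≟ p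
... | yes refl = divides c eq
... | no  i≢p  = ∣-reflexive (sym (f i i<3 i≢p))

module _ {m g} (ends : Ends m g) where
  open Ends ends
  private n = 6 + m

  d∣g : ∀ i → i < n → d ∣ g i
  d∣g = assemble (EndShape-∣ leftEnd) (λ i lo hi → ∣-reflexive (sym (steady i lo hi))) (EndShape-∣ rightEnd)

  -- The points are partial sums of the gaps starting from 0, so the common divisor of the gaps
  -- divides every element; this is where gcd 1 will force `d ≡ 1`.
  d∣point : ∀ i → i ≤ n → d ∣ point g i
  d∣point zero    _   = d ∣0
  d∣point (suc i) i<n = ∣m∣n⇒∣m+n (d∣point i (<⇒≤ i<n)) (d∣g i i<n)

-- Gap patterns that skip at most two integers

δ : ℕ → ℕ → ℕ
δ p i = if i ≡ᵇ p then 1 else 0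

-- The partial sums of `δ p`: 1 exactly at the points that lie beyond gap `p`.
θ : ℕ → ℕ → ℕ
θ p i = if p <ᵇ i then 1 else 0

θ-suc : ∀ p i → θ p (suc i) ≡ θ p i + δ p i
θ-suc zero    zero    = refl
θ-suc zero    (suc i) = refl
θ-suc (suc p) zero    = refl
θ-suc (suc p) (suc i) = θ-suc p i

θ-< : ∀ {p i} → p < i → θ p i ≡ 1
θ-< {p} {i} p<i with p <ᵇ i | <⇒<ᵇ p<i
... | true | _ = refl

θ-≥ : ∀ {p i} → i ≤ p → θ p i ≡ 0
θ-≥ {p} {i} i≤p with p <ᵇ i | <ᵇ⇒< p i
... | false | _ = refl
... | true  | f = contradiction (f tt) (≤⇒≯ i≤p)

δ-refl : ∀ p → δ p p ≡ 1
δ-refl zero    = refl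
δ-refl (suc p) = δ-refl p

δ-≢ : ∀ {p i} → i ≢ p → δ p i ≡ 0
δ-≢ {p} {i} i≢p with i ≡ᵇ p | ≡ᵇ⇒≡ i p
... | false | _ = refl
... | true  | f = contradiction (f tt) i≢p

-- Crossing gap p, and again gap q, skips one integer (two if p ≡ q); an index beyond the last gap skips nothing.
Skips : ℕ → (ℕ → ℕ) → ℕ → ℕ → Set
Skips n g p q = ∀ i → i < n → g i ≡ 1 + δ p i + δ q i

point-skips : ∀ {n g p q} → Skips n g p q → ∀ i → i ≤ n → point g i ≡ i + θ p i + θ q i
point-skips sk zero _ = refl
point-skips {p = p} {q} sk (suc i) i<n rewrite point-skips sk i (<⇒≤ i<n) | sk i i<n | θ-suc p i | θ-suc q i =
  arith i (θ p i) (θ q i) (δ p i) (δ q i)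
  where
  arith : ∀ i a b c d → i + a + b + (1 + c + d) ≡ suc i + (a + c) + (b + d)
  arith = solve-∀

skips-none : ∀ {n g} → (∀ i → i < n → g i ≡ 1) → Skips n g n n
skips-none ones i i<n rewrite δ-≢ (<⇒≢ i<n) = ones i i<n

skips-one : ∀ {n g p} → g p ≡ 2 → (∀ i → i < n → i ≢ p → g i ≡ 1) → Skips n g p n
skips-one {p = p} gp ones i i<n rewrite δ-≢ (<⇒≢ i<n) with i ≟ p
... | yes refl rewrite δ-refl p = gp
... | no  i≢p  rewrite δ-≢ i≢p  = ones i i<n i≢p

skips-twice : ∀ {n g p} → g p ≡ 3 → (∀ i → i < n → i ≢ p → g i ≡ 1) → Skips n g p p
skips-twice {p = p} gp ones i i<n with i ≟ p
... | yes refl rewrite δ-refl p = gp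
... | no  i≢p  rewrite δ-≢ i≢p  = ones i i<n i≢p

skips-two : ∀ {n g p q} → p ≢ q → g p ≡ 2 → g q ≡ 2 → (∀ i → i < n → i ≢ p → i ≢ q → g i ≡ 1) → Skips n g p q
skips-two {p = p} {q} p≢q gp gq ones i i<n with i ≟ p | i ≟ q
... | yes refl | yes refl = contradiction refl p≢q
... | yes refl | no i≢q rewrite δ-refl p | δ-≢ i≢q = gp
... | no i≢p | yes refl rewrite δ-refl q | δ-≢ i≢p = gq
... | no i≢p | no i≢q rewrite δ-≢ i≢p | δ-≢ i≢q = ones i i<n i≢p i≢q

-- The indices are gap numbers. With `k = 7 + m` the missing integers named by each constructor are
-- `suc p` and `2 + q`; `q = 6 + m` makes the upper endpoint `k + 1` missing.
data Exceptional (m : ℕ) : ℕ → ℕ → Set where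
  1,2     : Exceptional m 0 0
  k-1,k   : Exceptional m (5 + m) (5 + m)
  1,k     : Exceptional m 0 (5 + m)
  2,k+1   : Exceptional m 1 (6 + m)
  3,k+1   : Exceptional m 2 (6 + m)
  k-2,k+1 : Exceptional m (4 + m) (6 + m)
  k-3,k+1 : Exceptional m (3 + m) (6 + m)

-- The patterns of total cost at most one, to be excluded because their sums span too short an
-- interval.
data Dense (m : ℕ) : ℕ → ℕ → Set where
  none  : Dense m (6 + m) (6 + m)
  first : Dense m 0 (6 + m)
  last  : Dense m (5 + m) (6 + m)

Outcomes : ℕ → (ℕ → ℕ) → Set
Outcomes m g = (∃ λ p → ∃ λ q → Dense m p q × Skips (6 + m) g p q)
             ⊎ (∃ λ p → ∃ λ q → Exceptional m p q × Skips (6 + m) g p q)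

skips : ∀ {m g} (ends : Ends m g) → Ends.d ends ≡ 1 → Outcomes m g
skips {m} {g} record { steady = st ; leftEnd = sl ; rightEnd = sr ; excess = ex } refl = both sl sr ex
  where
  onlyLeft : ∀ {p c e} → Bump p c e → g p ≡ c * 1 → (∀ i → i < 6 + m → i ≢ p → g i ≡ 1) → Outcomes m g
  onlyLeft first-double  eq ones = inj₁ (_ , _ , first , skips-one eq ones)
  onlyLeft first-triple  eq ones = inj₂ (_ , _ , 1,2 , skips-twice eq ones)
  onlyLeft second-double eq ones = inj₂ (_ , _ , 2,k+1 , skips-one eq ones)
  onlyLeft third-double  eq ones = inj₂ (_ , _ , 3,k+1 , skips-one eq ones)

  onlyRight : ∀ {p c e} → Bump p c e → mirror (6 + m) g p ≡ c * 1 →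
    (∀ i → i < 6 + m → i ≢ 5 + m ∸ p → g i ≡ 1) → Outcomes m g
  onlyRight first-double  eq ones = inj₁ (_ , _ , last , skips-one eq ones)
  onlyRight first-triple  eq ones = inj₂ (_ , _ , k-1,k , skips-twice eq ones)
  onlyRight second-double eq ones = inj₂ (_ , _ , k-2,k+1 , skips-one eq ones)
  onlyRight third-double  eq ones = inj₂ (_ , _ , k-3,k+1 , skips-one eq ones)

  cost : ∀ {p c e} → Bump p c e → 1 ≤ e
  cost first-double  = auto
  cost first-triple  = auto
  cost second-double = auto
  cost third-double  = auto

  -- Every bump costs at least one and only `first-double` costs exactly one, so bumps at both ends
  -- within a total of two are both `first-double`: the case of 1 and `k`.
  both : ∀ {e e'} → EndShape g 1 e → EndShape (mirror (6 + m) g) 1 e' → e + e' ≤ 2 → Outcomes m g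
  both (flat l) (flat r) _ = inj₁ (_ , _ , none , skips-none (assemble l st r))
  both (bump b eq l) (flat r) _ =
    onlyLeft b eq (assemble l (λ i lo hi _ → st i lo hi) (λ j j<3 _ → r j j<3))
  both (flat l) (bump b eq r) _ =
    onlyRight b eq (assemble (λ i i<3 _ → l i i<3) (λ i lo hi _ → st i lo hi) (λ j j<3 ne → r j j<3 (ne ∘ cong (5 + m ∸_))))
  both (bump first-double eq l) (bump first-double eq' r) _ =
    inj₂ (_ , _ , 1,k , skips-two (λ ()) eq eq' (assemble (λ i i<3 ne _ → l i i<3 ne) (λ i lo hi _ _ → st i lo hi)
      (λ j j<3 _ ne → r j j<3 (ne ∘ cong (5 + m ∸_)))))
  both (bump first-triple _ _)  (bump b _ _) ex = contradiction (≤-trans (+-monoʳ-≤ 2 (cost b)) ex) λ { (s≤s (s≤s ())) }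
  both (bump second-double _ _) (bump b _ _) ex = contradiction (≤-trans (+-monoʳ-≤ 2 (cost b)) ex) λ { (s≤s (s≤s ())) }
  both (bump third-double _ _)  (bump b _ _) ex = contradiction (≤-trans (+-monoʳ-≤ 2 (cost b)) ex) λ { (s≤s (s≤s ())) }
  both (bump first-double _ _) (bump first-triple _ _)  (s≤s (s≤s ()))
  both (bump first-double _ _) (bump second-double _ _) (s≤s (s≤s ()))
  both (bump first-double _ _) (bump third-double _ _)  (s≤s (s≤s ()))

-- Counting with duplicate-free lists

lookup-injective : ∀ {A : Set} {xs : List A} → Unique xs → ∀ {i j} → lookup xs i ≡ lookup xs j → i ≡ j
lookup-injective (_ ∷ _)    {zero}  {zero}  _  = refl
lookup-injective {xs = _ ∷ xs} (x≢ ∷ _) {zero}  {suc j} eq = contradiction eq (All.lookup x≢ (∈-lookup {xs = xs} j))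
lookup-injective {xs = _ ∷ xs} (x≢ ∷ _) {suc i} {zero}  eq = contradiction (sym eq) (All.lookup x≢ (∈-lookup {xs = xs} i))
lookup-injective (_ ∷ xs!) {suc i} {suc j} eq = cong suc (lookup-injective xs! eq)

-- Sending each position in `xs` to a position of the same entry in `ys` is an injection between
-- finite index types.
unique-⊆⇒length≤ : ∀ {A : Set} {xs ys : List A} → Unique xs → (∀ {x} → x ∈ xs → x ∈ ys) → length xs ≤ length ys
unique-⊆⇒length≤ {xs = xs} {ys} xs! sub = injective⇒≤ {f = λ i → Any.index (member i)}
  (λ {i} {j} eq → lookup-injective xs! (trans (lookup-index (member i))
    (trans (cong (lookup ys) eq) (sym (lookup-index (member j))))))
  where
  member : ∀ i → lookup xs i ∈ ys
  member i = sub (∈-lookup {xs = xs} i)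

unique-interval⇒length≤ : ∀ {S : List ℤ} {lo hi} → Unique S →
  (∀ z → z ∈ S → ∃ λ v → z ≡ + v × lo ≤ v × v ≤ hi) → length S ≤ suc hi ∸ lo
unique-interval⇒length≤ {S} {lo} {hi} S! within = ≤-trans (unique-⊆⇒length≤ S! sub)
  (≤-reflexive (trans (length-map f (upTo (suc hi ∸ lo))) (length-upTo (suc hi ∸ lo))))
  where
  f : ℕ → ℤ
  f t = + (lo + t)
  sub : ∀ {z} → z ∈ S → z ∈ map f (upTo (suc hi ∸ lo))
  sub {z} z∈ with within z z∈
  ... | v , refl , lo≤v , v≤hi = subst (_∈ map f (upTo (suc hi ∸ lo))) (cong +_ (m+[n∸m]≡n lo≤v))
    (∈-map⁺ f (∈-upTo⁺ (∸-monoˡ-< (s≤s v≤hi) lo≤v)))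

-- Coding a set of integers by its gaps

-- Beyond the list the gaps are 1, so that all gaps are positive.
gapsFrom : ℕ → List ℕ → ℕ → ℕ
gapsFrom x []       _       = 1
gapsFrom x (y ∷ ys) zero    = y ∸ x
gapsFrom x (y ∷ ys) (suc i) = gapsFrom y ys i

gapsFrom>0 : ∀ {x ys} → AllPairs _<_ (x ∷ ys) → ∀ i → 0 < gapsFrom x ys i
gapsFrom>0 {ys = []}     _                     _       = z<s
gapsFrom>0 {ys = y ∷ ys} ((x<y ∷ _) ∷ _)       zero    = m<n⇒0<n∸m x<y
gapsFrom>0 {ys = y ∷ ys} (_ ∷ sorted)          (suc i) = gapsFrom>0 sorted i

point-suc : ∀ g i → point g (suc i) ≡ g 0 + point (g ∘ suc) i
point-suc g zero    = +-comm 0 (g 0)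
point-suc g (suc i) = trans (cong (_+ g (suc i)) (point-suc g i)) (+-assoc (g 0) _ _)

x+point : ∀ {x y} ys → x < y → ∀ i → x + point (gapsFrom x (y ∷ ys)) (suc i) ≡ y + point (gapsFrom y ys) i
x+point {x} {y} ys x<y i = begin
  x + point (gapsFrom x (y ∷ ys)) (suc i)     ≡⟨ cong (_+_ x) (point-suc (gapsFrom x (y ∷ ys)) i) ⟩
  x + (y ∸ x + point (gapsFrom y ys) i)       ≡⟨ sym (+-assoc x (y ∸ x) _) ⟩
  x + (y ∸ x) + point (gapsFrom y ys) i       ≡⟨ cong (_+ point (gapsFrom y ys) i) (m+[n∸m]≡n (<⇒≤ x<y)) ⟩
  y + point (gapsFrom y ys) i                 ∎
  where open ≡-Reasoning

∈⇒point : ∀ {x ys} → AllPairs _<_ (x ∷ ys) → ∀ {v} → v ∈ x ∷ ys → ∃ λ i → i ≤ length ys × v ≡ x + point (gapsFrom x ys) i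
∈⇒point _ (here refl) = 0 , z≤n , sym (+-identityʳ _)
∈⇒point {ys = y ∷ ys} ((x<y ∷ _) ∷ sorted) (there v∈) with ∈⇒point sorted v∈
... | i , i≤ , refl = suc i , s≤s i≤ , sym (x+point ys x<y i)

point⇒∈ : ∀ {x ys} → AllPairs _<_ (x ∷ ys) → ∀ i → i ≤ length ys → x + point (gapsFrom x ys) i ∈ x ∷ ys
point⇒∈ {x} _ zero _ = here (+-identityʳ x)
point⇒∈ {x} {y ∷ ys} ((x<y ∷ _) ∷ sorted) (suc i) (s≤s i≤) =
  there (subst (_∈ y ∷ ys) (sym (x+point ys x<y i)) (point⇒∈ sorted i i≤))

record GapCode (A : List ℤ) (n : ℕ) : Set where
  field
    gap   : ℕ → ℕ
    gap>0 : ∀ i → 0 < gap i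
    sound    : ∀ {z} → z ∈ A → ∃ λ i → i ≤ n × z ≡ + point gap i
    complete : ∀ i → i ≤ n → + point gap i ∈ A

unique-abs : ∀ {xs} → All (λ z → + 0 ℤ.≤ z) xs → Unique xs → Unique (map ∣_∣ xs)
unique-abs pos xs! = AllPairs.map⁺ (go pos xs!)
  where
  go : ∀ {xs} → All (λ z → + 0 ℤ.≤ z) xs → Unique xs → AllPairs (λ z w → ∣ z ∣ ≢ ∣ w ∣) xs
  go [] [] = []
  go (0≤x ∷ pos) (x≢ ∷ xs!) =
    All.zipWith (λ { (0≤y , x≢y) eq → x≢y (trans (sym (ℤ.0≤i⇒+∣i∣≡i 0≤x)) (trans (cong +_ eq) (ℤ.0≤i⇒+∣i∣≡i 0≤y))) }) (pos , x≢)
    ∷ go pos xs!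

gapCode : ∀ {n} (A : List ℤ) → Unique A → length A ≡ suc n → MinIsZero A → GapCode A n
gapCode {n} A A! |A| (0∈A , A≥0) = build (sort B) refl
  where
  B = map ∣_∣ A
  -- The sorted list is generalised to `C` with an equation, so that its head and tail can be
  -- matched.
  build : ∀ C → C ≡ sort B → GapCode A n
  build [] eq with () ← trans (sym |A|) (trans (sym (length-map ∣_∣ A)) (trans (sym (↭-length (sort-↭ B))) (cong length (sym eq))))
  build (x ∷ ys) eq = record
    { gap = gapsFrom x ys
    ; gap>0 = gapsFrom>0 sorted
    ; sound = λ z∈A → let i , i≤ , e = ∈⇒point sorted (from-A z∈A) in
        i , subst (i ≤_) |ys| i≤ ,
        trans (sym (ℤ.0≤i⇒+∣i∣≡i (A≥0 _ z∈A))) (cong +_ (trans e (cong (_+ point (gapsFrom x ys) i) x≡0)))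
    ; complete = λ i i≤n → to-A (subst (λ t → t + point (gapsFrom x ys) i ∈ x ∷ ys) x≡0
        (point⇒∈ sorted i (subst (i ≤_) (sym |ys|) i≤n)))
    }
    where
    perm : x ∷ ys ↭ B
    perm = subst (_↭ B) (sym eq) (sort-↭ B)
    sorted : AllPairs _<_ (x ∷ ys)
    sorted = AllPairs.zipWith (λ { (le , ne) → ≤∧≢⇒< le ne })
      ( subst (AllPairs _≤_) (sym eq) (Sorted⇒AllPairs ≤-totalOrder (sort-↗ B))
      , Permutation.Unique-resp-↭ (setoid ℕ) (↭⇒↭ₛ (↭-sym perm)) (unique-abs (All.tabulate (λ {z} → A≥0 z)) A!))
    |ys| : length ys ≡ n
    |ys| = suc-injective (trans (↭-length perm) (trans (length-map ∣_∣ A) |A|))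
    from-A : ∀ {z} → z ∈ A → ∣ z ∣ ∈ x ∷ ys
    from-A z∈A = ∈-resp-↭ (↭-sym perm) (∈-map⁺ ∣_∣ z∈A)
    to-A : ∀ {v} → v ∈ x ∷ ys → + v ∈ A
    to-A v∈ with ∈-map⁻ ∣_∣ (∈-resp-↭ perm v∈)
    ... | z , z∈A , refl = subst (_∈ A) (sym (ℤ.0≤i⇒+∣i∣≡i (A≥0 z z∈A))) z∈A
    x≡0 : x ≡ 0
    x≡0 with from-A 0∈A
    ... | here e = sym e
    -- A 0 in the tail would be strictly above the head `x`, which is impossible in the naturals.
    ... | there 0∈ys with () ← All.lookup (AllPairs.head sorted) 0∈ys

gcdList-greatest : ∀ {c} A → (∀ {z} → z ∈ A → + c ℤ.∣ z) → + c ℤ.∣ gcdList A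
gcdList-greatest {c} []      _   = c ∣0
gcdList-greatest {c} (x ∷ A) div = ℤ.gcd-greatest {x} {gcdList A} {+ c} (div (here refl)) (gcdList-greatest A (div ∘ there))

-- From skipped gaps to an interval without two points

module _ {n g p q} (p≤q : p ≤ q) (q≤n : q ≤ n) (sk : Skips n g p q) where

  point-below : ∀ {i} → i ≤ p → point g i ≡ i
  point-below {i} i≤p rewrite point-skips sk i (≤-trans i≤p (≤-trans p≤q q≤n)) | θ-≥ i≤p | θ-≥ (≤-trans i≤p p≤q) =
    trans (+-identityʳ (i + 0)) (+-identityʳ i)

  point-between : ∀ {i} → p < i → i ≤ q → point g i ≡ suc i
  point-between {i} p<i i≤q rewrite point-skips sk i (≤-trans i≤q q≤n) | θ-< p<i | θ-≥ i≤q =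
    trans (+-identityʳ (i + 1)) (+-comm i 1)

  point-beyond : ∀ {i} → q < i → i ≤ n → point g i ≡ 2 + i
  point-beyond {i} q<i i≤n rewrite point-skips sk i i≤n | θ-< (≤-<-trans p≤q q<i) | θ-< q<i =
    trans (+-assoc i 1 1) (+-comm i 2)

-- Points equal their index up to `p`, are shifted by 1 up to `q` and by 2 beyond, so exactly
-- `suc p` and `2 + q` are jumped over. For `p ≡ q` the middle block is empty; for `q ≡ n` the last
-- block is.
skips⇒interval : ∀ {A k n p q x y} (code : GapCode A n) → p ≤ q → q ≤ n → Skips n (GapCode.gap code) p q →
  k ≡ suc n → x ≡ suc p → y ≡ 2 + q → IsIntervalMinusTwo A k (+ x) (+ y)
skips⇒interval {A} {n = n} {p} {q} code p≤q q≤n sk refl refl refl z = mk⇔ to from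
  where
  open GapCode code

  inside : ∀ {v} → v ≤ 2 + n → v ≢ suc p → v ≢ 2 + q →
    (+ 0 ℤ.≤ + v × + v ℤ.≤ + (suc n + 1)) × + v ≢ + suc p × + v ≢ + (2 + q)
  inside le ne ne' = (ℤ.+≤+ z≤n , ℤ.+≤+ (≤-trans le (≤-reflexive (+-comm 1 (suc n))))) , ne ∘ ℤ.+-injective , ne' ∘ ℤ.+-injective

  to : z ∈ A → (+ 0 ℤ.≤ z × z ℤ.≤ + (suc n + 1)) × z ≢ + suc p × z ≢ + (2 + q)
  to z∈A with sound z∈A
  ... | i , i≤n , refl with i ≤? p
  ... | yes i≤p rewrite point-below p≤q q≤n sk i≤p = inside (≤-trans i≤n (m≤n+m n 2)) (<⇒≢ (s≤s i≤p)) (<⇒≢ (s≤s (≤-trans i≤p (≤-trans p≤q (n≤1+n q)))))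
  ... | no  i≰p with i ≤? q
  ... | yes i≤q rewrite point-between p≤q q≤n sk (≰⇒> i≰p) i≤q = inside (s≤s (≤-trans i≤n (n≤1+n n))) (>⇒≢ (s≤s (≰⇒> i≰p))) (<⇒≢ (s≤s (s≤s i≤q)))
  ... | no  i≰q rewrite point-beyond p≤q q≤n sk (≰⇒> i≰q) i≤n = inside (s≤s (s≤s i≤n)) (>⇒≢ (s≤s (s≤s (<⇒≤ (≰⇒> i≰p))))) (>⇒≢ (s≤s (s≤s (≰⇒> i≰q))))

  member : ∀ {i v} → i ≤ n → point gap i ≡ v → + v ∈ A
  member i≤n refl = complete _ i≤n

  from : (+ 0 ℤ.≤ z × z ℤ.≤ + (suc n + 1)) × z ≢ + suc p × z ≢ + (2 + q) → z ∈ A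
  from ((ℤ.+≤+ {n = v} _ , ℤ.+≤+ v≤) , v≢x , v≢y) with <-cmp v (suc p)
  ... | tri< v<x _ _ = member (≤-trans (≤-pred v<x) (≤-trans p≤q q≤n)) (point-below p≤q q≤n sk (≤-pred v<x))
  ... | tri≈ _ v≡x _ = contradiction (cong +_ v≡x) v≢x
  from ((ℤ.+≤+ {n = suc v} _ , ℤ.+≤+ v≤) , v≢x , v≢y) | tri> _ _ x<v with <-cmp v (suc q)
  ... | tri< v<y _ _ = member (≤-trans (≤-pred v<y) q≤n) (point-between p≤q q≤n sk (≤-pred x<v) (≤-pred v<y))
  ... | tri≈ _ v≡y _ = contradiction (cong (+_ ∘ suc) v≡y) v≢y
  from ((ℤ.+≤+ {n = suc (suc v)} _ , ℤ.+≤+ v≤) , v≢x , v≢y) | tri> _ _ x<v | tri> _ _ y<v =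
    member v≤n (point-beyond p≤q q≤n sk (≤-pred y<v) v≤n)
    where v≤n = ≤-pred (≤-pred (≤-trans v≤ (≤-reflexive (+-comm (suc n) 1))))

-- The restricted sumset in terms of index triples

module Sumset {A n} (code : GapCode A n) where
  open GapCode code

  point-mono : ∀ {i j} → i < j → point gap i < point gap j
  point-mono {i} {suc j} (s≤s i≤j) with i ≟ j
  ... | yes refl = m<m+n (point gap i) (gap>0 i)
  ... | no  i≢j  = <-trans (point-mono (≤∧≢⇒< i≤j i≢j)) (m<m+n (point gap j) (gap>0 j))

  value∈ : ∀ {V} → Valid n V → InRestricted3Sum A (+ value gap V)
  value∈ {i , j , l} (i<j , j<l , l≤n) = + point gap i , + point gap j , + point gap l ,
    complete i (<⇒≤ (<-≤-trans (<-trans i<j j<l) l≤n)) , complete j (<⇒≤ (<-≤-trans j<l l≤n)) , complete l l≤n ,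
    apart i<j , apart (<-trans i<j j<l) , apart j<l , refl
    where
    apart : ∀ {i j} → i < j → + point gap i ≢ + point gap j
    apart i<j = <⇒≢ (point-mono i<j) ∘ ℤ.+-injective

  -- Distinct summands have distinct indices, which three comparisons sort. In the two monotone
  -- cases the comparison of `i` with `l` is left open, which also absorbs the cyclic patterns.
  ∈value : ∀ {z} → InRestricted3Sum A z → ∃ λ V → Valid n V × z ≡ + value gap V
  ∈value (_ , _ , _ , a∈ , b∈ , c∈ , a≢b , a≢c , b≢c , refl) with sound a∈ | sound b∈ | sound c∈
  ... | i , i≤ , refl | j , j≤ , refl | l , l≤ , refl with <-cmp i j | <-cmp i l | <-cmp j l
  ... | tri≈ _ refl _ | _ | _ = contradiction refl a≢b
  ... | _ | tri≈ _ refl _ | _ = contradiction refl a≢c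
  ... | _ | _ | tri≈ _ refl _ = contradiction refl b≢c
  ... | tri< i<j _ _ | _ | tri< j<l _ _ = (i , j , l) , (i<j , j<l , l≤) , refl
  ... | tri< _ _ _ | tri< i<l _ _ | tri> _ _ l<j = (i , l , j) , (i<l , l<j , j≤) , cong +_ (arith (point gap i) (point gap j) (point gap l))
    where
    arith : ∀ a b c → a + b + c ≡ a + c + b
    arith = solve-∀
  ... | tri< i<j _ _ | tri> _ _ l<i | tri> _ _ _ = (l , i , j) , (l<i , i<j , j≤) , cong +_ (arith (point gap i) (point gap j) (point gap l))
    where
    arith : ∀ a b c → a + b + c ≡ c + a + b
    arith = solve-∀
  ... | tri> _ _ j<i | tri< i<l _ _ | tri< _ _ _ = (j , i , l) , (j<i , i<l , l≤) , cong +_ (arith (point gap i) (point gap j) (point gap l))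
    where
    arith : ∀ a b c → a + b + c ≡ b + a + c
    arith = solve-∀
  ... | tri> _ _ _ | tri> _ _ l<i | tri< j<l _ _ = (j , l , i) , (j<l , l<i , i≤) , cong +_ (arith (point gap i) (point gap j) (point gap l))
    where
    arith : ∀ a b c → a + b + c ≡ b + c + a
    arith = solve-∀
  ... | tri> _ _ j<i | _ | tri> _ _ l<j = (l , j , i) , (l<j , j<i , i≤) , cong +_ (arith (point gap i) (point gap j) (point gap l))
    where
    arith : ∀ a b c → a + b + c ≡ c + b + a
    arith = solve-∀

  -- Triples with different sums give different entries of the list `S`.
  card⇒AtMost : ∀ {N} → HasCard (InRestricted3Sum A) N → AtMost gap n N
  card⇒AtMost (S , _ , refl , S⇔) Vs valid distinct =
    subst (_≤ length S) (length-map f Vs) (unique-⊆⇒length≤ (AllPairs.map⁺ (AllPairs.map (_∘ ℤ.+-injective) distinct)) sub)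
    where
    f : Triple → ℤ
    f V = + value gap V
    sub : ∀ {z} → z ∈ map f Vs → z ∈ S
    sub z∈ with ∈-map⁻ f z∈
    ... | V , V∈ , refl = Equivalence.from (S⇔ _) (value∈ (All.lookup valid V∈))

  card⇒spread : ∀ {N lo hi} → HasCard (InRestricted3Sum A) N →
    (∀ V → Valid n V → lo ≤ value gap V × value gap V ≤ hi) → N ≤ suc hi ∸ lo
  card⇒spread (S , S! , refl , S⇔) bounds = unique-interval⇒length≤ S! within
    where
    within : ∀ z → z ∈ S → _
    within z z∈ with ∈value (Equivalence.to (S⇔ z) z∈)
    ... | V , v , e = value gap V , e , bounds V v

-- Excluding the dense patterns

dense-spread : ∀ {m g p q} → Dense m p q → Skips (6 + m) g p q →
  suc (value g (reflect (6 + m) start)) ∸ value g start < 15 + 3 * m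
dense-spread {m} {g} {p} {q} dense sk = go dense sk
  where
  -- Once the six extreme points are replaced by explicit values, the truncated subtraction reduces.
  -- The interval of sums has `13 + 3 * m` integers for `none` and `14 + 3 * m` for `first` and
  -- `last`.
  spread : ∀ a b c a′ b′ c′ → point g 0 ≡ a → point g 1 ≡ b → point g 2 ≡ c →
    point g (4 + m) ≡ a′ → point g (5 + m) ≡ b′ → point g (6 + m) ≡ c′ →
    suc (a′ + b′ + c′) ∸ (a + b + c) < 15 + 3 * m →
    suc (value g (reflect (6 + m) start)) ∸ value g start < 15 + 3 * m
  spread _ _ _ _ _ _ refl refl refl refl refl refl lt = lt

  go : ∀ {p q} → Dense m p q → Skips (6 + m) g p q → suc (value g (reflect (6 + m) start)) ∸ value g start < 15 + 3 * m
  go none sk = spread 0 1 2 (4 + m) (5 + m) (6 + m)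
    (low auto) (low auto) (low auto) (low (m≤n+m (4 + m) 2)) (low (n≤1+n _)) (low ≤-refl)
    (≤-trans (≤-reflexive (arith m)) (n≤1+n (14 + 3 * m)))
    where
    low : ∀ {i} → i ≤ 6 + m → point g i ≡ i
    low = point-below ≤-refl ≤-refl sk
    arith : ∀ m → suc (2 + m + (5 + m) + (6 + m)) ≡ 14 + 3 * m
    arith = solve-∀
  go first sk = spread 0 2 3 (5 + m) (6 + m) (7 + m)
    (point-below z≤n ≤-refl sk z≤n) (high auto auto) (high auto auto) (high auto (m≤n+m (4 + m) 2)) (high auto (n≤1+n _)) (high auto ≤-refl)
    (≤-reflexive (arith m))
    where
    high : ∀ {i} → 0 < i → i ≤ 6 + m → point g i ≡ suc i
    high = point-between z≤n ≤-refl sk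
    arith : ∀ m → suc (suc m + (6 + m) + (7 + m)) ≡ 15 + 3 * m
    arith = solve-∀
  go last sk = spread 0 1 2 (4 + m) (5 + m) (7 + m)
    (low auto) (low auto) (low auto) (low (n≤1+n _)) (low ≤-refl) (point-between (n≤1+n _) ≤-refl sk ≤-refl ≤-refl)
    (≤-reflexive (arith m))
    where
    low : ∀ {i} → i ≤ 5 + m → point g i ≡ i
    low = point-below (n≤1+n (5 + m)) ≤-refl sk
    arith : ∀ m → suc (2 + m + (5 + m) + (7 + m)) ≡ 15 + 3 * m
    arith = solve-∀

-- The classification

Conclusion : ℕ → List ℤ → Set
Conclusion k A =
    IsIntervalMinusTwo A k (+ 1) (+ 2)
    ⊎ IsIntervalMinusTwo A k (+ (k ∸ 1)) (+ k)
    ⊎ IsIntervalMinusTwo A k (+ 1) (+ k)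
    ⊎ IsIntervalMinusTwo A k (+ 2) (+ (k + 1))
    ⊎ IsIntervalMinusTwo A k (+ 3) (+ (k + 1))
    ⊎ IsIntervalMinusTwo A k (+ (k ∸ 2)) (+ (k + 1))
    ⊎ IsIntervalMinusTwo A k (+ (k ∸ 3)) (+ (k + 1))

exceptional⇒conclusion : ∀ {m A p q} (code : GapCode A (6 + m)) → Exceptional m p q →
  Skips (6 + m) (GapCode.gap code) p q → Conclusion (7 + m) A
exceptional⇒conclusion {m} code 1,2 sk = inj₁ (skips⇒interval code z≤n z≤n sk refl refl refl)
exceptional⇒conclusion {m} code k-1,k sk = inj₂ (inj₁ (skips⇒interval code ≤-refl (n≤1+n _) sk refl refl refl))
exceptional⇒conclusion {m} code 1,k sk = inj₂ (inj₂ (inj₁ (skips⇒interval code z≤n (n≤1+n _) sk refl refl refl)))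
exceptional⇒conclusion {m} code 2,k+1 sk = inj₂ (inj₂ (inj₂ (inj₁
  (skips⇒interval code auto ≤-refl sk refl refl (+-comm (7 + m) 1)))))
exceptional⇒conclusion {m} code 3,k+1 sk = inj₂ (inj₂ (inj₂ (inj₂ (inj₁
  (skips⇒interval code auto ≤-refl sk refl refl (+-comm (7 + m) 1))))))
exceptional⇒conclusion {m} code k-2,k+1 sk = inj₂ (inj₂ (inj₂ (inj₂ (inj₂ (inj₁
  (skips⇒interval code (m≤n+m (4 + m) 2) ≤-refl sk refl refl (+-comm (7 + m) 1)))))))
exceptional⇒conclusion {m} code k-3,k+1 sk = inj₂ (inj₂ (inj₂ (inj₂ (inj₂ (inj₂
  (skips⇒interval code (m≤n+m (3 + m) 3) ≤-refl sk refl refl (+-comm (7 + m) 1)))))))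

module _ {m A} (5≤m : 5 ≤ m) (code : GapCode A (6 + m)) (gcd≡1 : gcdList A ≡ + 1)
  (card : HasCard (InRestricted3Sum A) (15 + 3 * m)) where

  open GapCode code
  open Sumset code
  open Structure m 5≤m gap gap>0 (card⇒AtMost card) using (ends; value-bounds)

  d≡1 : Ends.d ends ≡ 1
  d≡1 = ∣1⇒≡1 (subst (λ z → + Ends.d ends ℤ.∣ z) gcd≡1 (gcdList-greatest A divides-A))
    where
    divides-A : ∀ {z} → z ∈ A → + Ends.d ends ℤ.∣ z
    divides-A z∈A with sound z∈A
    ... | i , i≤n , refl = d∣point ends i i≤n

  conclusion : Conclusion (7 + m) A
  conclusion with skips ends d≡1
  -- All sums would lie in an interval with fewer than `15 + 3 * m` integers.
  ... | inj₁ (_ , _ , dense , sk) = contradiction (card⇒spread card value-bounds) (<⇒≱ (dense-spread dense sk))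
  ... | inj₂ (_ , _ , exc , sk)   = exceptional⇒conclusion code exc sk

3k∸6 : ∀ m → 3 * (7 + m) ∸ 6 ≡ 15 + 3 * m
3k∸6 m = trans (cong (_∸ 6) (*-distribˡ-+ 3 7 m)) refl

classification : ∀ {m k A} → 5 ≤ m → k ≡ 7 + m → Unique A → length A ≡ k → MinIsZero A → gcdList A ≡ + 1 →
  HasCard (InRestricted3Sum A) (3 * k ∸ 6) → Conclusion k A
classification {m} {A = A} 5≤m refl A! |A| min gcd≡1 card =
  conclusion 5≤m (gapCode A A! |A| min) gcd≡1 (subst (HasCard (InRestricted3Sum A)) (3k∸6 m) card)

theorem1p11 : (k : ℕ) → 12 ≤ k → (A : List ℤ) → Unique A → length A ≡ k →
    MinIsZero A → gcdList A ≡ + 1 →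
    HasCard (InRestricted3Sum A) (3 * k ∸ 6) →
    IsIntervalMinusTwo A k (+ 1) (+ 2)
    ⊎ IsIntervalMinusTwo A k (+ (k ∸ 1)) (+ k)
    ⊎ IsIntervalMinusTwo A k (+ 1) (+ k)
    ⊎ IsIntervalMinusTwo A k (+ 2) (+ (k + 1))
    ⊎ IsIntervalMinusTwo A k (+ 3) (+ (k + 1))
    ⊎ IsIntervalMinusTwo A k (+ (k ∸ 2)) (+ (k + 1))
    ⊎ IsIntervalMinusTwo A k (+ (k ∸ 3)) (+ (k + 1))
theorem1p11 k 12≤k A A! |A| min gcd≡1 card =
  -- Here `m = k ∸ 7`, so `12 ≤ k` becomes `5 ≤ m`.
  classification (∸-monoˡ-≤ 7 12≤k) (sym (m+[n∸m]≡n {7} (≤-trans (auto {7} {12}) 12≤k))) A! |A| min gcd≡1 card
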